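{- The category $\mathsf{Freyd}$ of (strict) Freyd categories and functors of Freyd categories is isomorphic to the category $\mathsf{Cart}\mathbf{2}\text{ - }\mathsf{GradMon}$ of cartesian $\mathbf{2}$-graded monoidal categories.
   Context: **PCMs.** A partial commutative monoid (PCM) $(E,\oplus,0)$ is a set $E$ with a partial function $\oplus:E\times E\rightharpoonup E$ and an element $0\in E$ such that $a\oplus b\simeq b\oplus a$, $a\oplus 0=a=0\oplus a$, $(a\oplus b)\oplus c\simeq a\oplus(b\oplus c)$, where $\simeq$ means: if either side is defined then both are, and they are equal. Write $a\perp b$ when $a\oplus b$ is defined. The extension preorder on $E$ is: $a\leqslant b$ iff there is $c$ with $a\oplus c=b$. The PCM $\mathbf{2}$ has elements $0,1$ with $0\oplus0=0$, $0\oplus1=1\oplus0=1$, and $1\oplus1$ undefined. **Graded monoidal categories.** For a PCM $E$, an $E$-graded monoidal category $\mathbb{C}$ consists of: a monoid of objects $(\mathbb{C}_{\mathrm{obj}},\otimes,I)$; for each $a\in E$ a category $\mathbb{C}_a$ with set of objects $\mathbb{C}_{\mathrm{obj}}$, hom-sets $\mathbb{C}_a(X;Y)$, composition written diagrammatically $f;g$; the identities of $\mathbb{C}_0$ are written $\mathrm{id}_X$; for each $a\leqslant b$ an identity-on-objects functor $(-)_a^b:\mathbb{C}_a\to\mathbb{C}_b$ (regrading); for each $a\perp b$ operations $\otimes_{a,b}:\mathbb{C}_a(X;Y)\times\mathbb{C}_b(X';Y')\to\mathbb{C}_{a\oplus b}(X\otimes X';Y\otimes Y')$. Axioms, whenever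 well typed: $f_a^a=f$ and $(f_a^b)_b^c=f_a^c$; $(f\otimes g)_{a\oplus b}^{c\oplus d}=f_a^c\otimes g_b^d$ for $f\in\mathbb{C}_a$, $g\in\mathbb{C}_b$, $a\leqslant c$, $b\leqslant d$, $c\perp d$; $f\otimes\mathrm{id}_I=f=\mathrm{id}_I\otimes f$ and $(f\otimes g)\otimes h=f\otimes(g\otimes h)$; $\mathrm{id}_X\otimes\mathrm{id}_Y=\mathrm{id}_{X\otimes Y}$; $(f\otimes g);(h\otimes k)=(f;h)\otimes(g;k)$ for $f\in\mathbb{C}_a(X;Y)$, $h\in\mathbb{C}_a(Y;Z)$, $g\in\mathbb{C}_b(X';Y')$, $k\in\mathbb{C}_b(Y';Z')$. In particular $\mathbb{C}_0$ is a strict monoidal category with $\otimes_{0,0}$. **Symmetric and cartesian structure.** A symmetric strict monoidal category is a strict monoidal category with natural braidings $\sigma_{X,Y}:X\otimes Y\to Y\otimes X$ with $\sigma_{X,Y};\sigma_{Y,X}=\mathrm{id}$, $(\sigma_{X,Y}\otimes\mathrm{id}_Z);(\mathrm{id}_Y\otimes\sigma_{X,Z})=\sigma_{X,Y\otimes Z}$, $\sigma_{X,I}=\mathrm{id}_X$. A cartesian monoidal category is a strict monoidal category whose monoidal product is given by a chosen categorical product and whose unit $I$ is terminal (i.e. $\mathrm{id}_A\otimes{!_B}$ and ${!_A}\otimes\mathrm{id}_B$ exhibit $A\otimes B$ as a product of $A$ and $B$); it is symmetric with the canonical braiding. A cartesian monoidal functor between cartesian monoidal categories is a strict monoidal functor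 (a functor that is a monoid homomorphism on objects and preserves $\otimes$ of morphisms). An $E$-graded monoidal category $\mathbb{C}$ is symmetric if $\mathbb{C}_0$ is symmetric strict monoidal with braidings $\sigma$ such that for all $a\perp b$, $f\in\mathbb{C}_a(X;Y)$, $g\in\mathbb{C}_b(X';Y')$: $(f\otimes g);(\sigma_{Y,Y'})_0^{a\oplus b}=(\sigma_{X,X'})_0^{a\oplus b};(g\otimes f)$. It is cartesian if $\mathbb{C}_0$ is a cartesian monoidal category whose braiding makes $\mathbb{C}$ symmetric. **Category $\mathsf{Cart}\mathbf{2}\text{ - }\mathsf{GradMon}$.** Objects: cartesian $\mathbf{2}$-graded monoidal categories. A morphism $M:\mathbb{C}\to\mathbb{D}$ is a monoid homomorphism $M:\mathbb{C}_{\mathrm{obj}}\to\mathbb{D}_{\mathrm{obj}}$ with functors $M_e:\mathbb{C}_e\to\mathbb{D}_e$ ($e\in\mathbf{2}$) with action $M$ on objects, such that $M_{e\oplus e'}(g\otimes h)=M_e(g)\otimes M_{e'}(h)$ for $e\perp e'$, $M_f(g_e^f)=M_e(g)_e^f$ for $e\leqslant f$, and $M_0$ is a cartesian monoidal functor. **Freyd categories.** A strict premonoidal category is a category with an object $A\otimes B$ for each pair of objects, an object $I$, functors $A\ltimes-$ sending object $B$ to $A\otimes B$ and functors $-\rtimes A$ sending object $B$ to $B\otimes A$, such that $\otimes$ on objects is associative and unital with unit $I$, and $(A\ltimes f)\rtimes B=A\ltimes(f\rtimes B)$, $(A\otimes B)\ltimes f=A\ltimes(B\ltimes f)$, $f\rtimes(A\otimes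 B)=(f\rtimes A)\rtimes B$, $I\ltimes f=f=f\rtimes I$. A morphism $f:A\to B$ is central if for every $g:C\to D$, $(A\ltimes g);(f\rtimes D)=(f\rtimes C);(B\ltimes g)$ and $(g\rtimes A);(D\ltimes f)=(C\ltimes f);(g\rtimes B)$. A symmetric strict premonoidal category has in addition central braidings $\sigma_{X,Y}:X\otimes Y\to Y\otimes X$, natural (i.e. $(f\rtimes Z);\sigma_{Y,Z}=\sigma_{X,Z};(Z\ltimes f)$ for $f:X\to Y$, and symmetrically), with $\sigma_{X,Y};\sigma_{Y,X}=\mathrm{id}$, $(\sigma_{X,Y}\rtimes Z);(Y\ltimes\sigma_{X,Z})=\sigma_{X,Y\otimes Z}$, $\sigma_{X,I}=\mathrm{id}_X$. A (symmetric) strict premonoidal functor is a functor that is a monoid homomorphism on objects and preserves both whiskerings (and braidings); strict monoidal categories are premonoidal via $A\ltimes f=\mathrm{id}_A\otimes f$, $f\rtimes A=f\otimes\mathrm{id}_A$. A symmetric strict effectful category $(\mathbb{V},\mathbb{C},\eta)$ is a symmetric strict monoidal category $\mathbb{V}$, a symmetric strict premonoidal category $\mathbb{C}$, and an identity-on-objects strict premonoidal functor $\eta:\mathbb{V}\to\mathbb{C}$ preserving braidings and taking central values on morphisms. A (strict) Freyd category is a symmetric strict effectful category in which $\mathbb{V}$ is a cartesian monoidal category. A functor of Freyd categories $(F_0,F_1):(\mathbb{V},\mathbb{C},\eta)\to(\mathbb{V}',\mathbb{C}',\eta')$ is a cartesian monoidal functor $F_0:\mathbb{V}\to\mathbb{V}'$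 preserving braidings and a symmetric strict premonoidal functor $F_1:\mathbb{C}\to\mathbb{C}'$ with $F_1\circ\eta=\eta'\circ F_0$. -}

module Defs where

open import Algebra.Bundles using (Monoid)
open import Algebra.Morphism.Bundles using (MonoidHomomorphism)
import Algebra.Morphism.Construct.Composition as Composition
import Algebra.Morphism.Construct.Identity as Identity
import Algebra.Structures as Structures
open import Data.Maybe.Base using (Maybe; just; nothing; _>>=_)
open import Data.Product.Base using (_×_; _,_; ∃-syntax)
open import Function.Base using (id; _∘_)
open import Level using (Level; _⊔_; suc; 0ℓ)
open import Relation.Binary.HeterogeneousEquality as ≅ using (_≅_; refl; ≡-to-≅)
open import Relation.Binary.PropositionalEquality as ≡ using (_≡_; refl; subst₂)
open import Relation.Binary.Structures using (IsEquivalence)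

private
  variable
    e o ℓ r o′ ℓ′ r′ o″ ℓ″ : Level

-- Partial commutative monoids.  The partial operation is Maybe-valued, so that
-- Kleene equality of partial expressions is propositional equality.

record PCM e : Set (suc e) where
  infixl 7 _⊕_
  infix 4 _⊕_↦_ _⩽_
  field
    Carrier   : Set e
    _⊕_       : Carrier → Carrier → Maybe Carrier
    𝟘         : Carrier
    comm      : ∀ a b → a ⊕ b ≡ b ⊕ a
    identityˡ : ∀ a → 𝟘 ⊕ a ≡ just a
    identityʳ : ∀ a → a ⊕ 𝟘 ≡ just a
    assoc     : ∀ a b c → ((a ⊕ b) >>= (_⊕ c)) ≡ ((b ⊕ c) >>= (a ⊕_))

  -- "a ⊥ b, and a ⊕ b is c".
  _⊕_↦_ : Carrier → Carrier → Carrier → Set e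
  a ⊕ b ↦ c = a ⊕ b ≡ just c

  _⩽_ : Carrier → Carrier → Set e
  a ⩽ b = ∃[ c ] a ⊕ c ↦ b

  𝟘⩽ : ∀ a → 𝟘 ⩽ a
  𝟘⩽ a = a , identityˡ a

data Two : Set where
  zero one : Two

𝟐 : PCM 0ℓ
𝟐 = record
  { Carrier   = Two
  ; _⊕_       = _⊕_
  ; 𝟘         = zero
  ; comm      = λ { zero zero → refl ; zero one → refl ; one zero → refl ; one one → refl }
  ; identityˡ = λ _ → refl
  ; identityʳ = λ { zero → refl ; one → refl }
  ; assoc     = λ { zero b c → assoc₀ b c
                  ; one zero c → refl ; one one zero → refl ; one one one → refl }
  }
  where
  _⊕_ : Two → Two → Maybe Two
  zero ⊕ b    = just b
  one  ⊕ zero = just one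
  one  ⊕ one  = nothing

  assoc₀ : ∀ b c → (b ⊕ c) ≡ ((b ⊕ c) >>= just)
  assoc₀ zero c    = refl
  assoc₀ one  zero = refl
  assoc₀ one  one  = refl

-- Small categories are strict: objects and morphisms are compared by
-- propositional equality.  The object type is a parameter because several
-- categories below share their objects.

record CategoryOn (Obj : Set o) ℓ : Set (o ⊔ suc ℓ) where
  infixl 6 _⨾_
  field
    Hom       : Obj → Obj → Set ℓ
    id→       : ∀ {X} → Hom X X
    _⨾_       : ∀ {X Y Z} → Hom X Y → Hom Y Z → Hom X Z
    identityˡ : ∀ {X Y} (f : Hom X Y) → id→ ⨾ f ≡ f
    identityʳ : ∀ {X Y} (f : Hom X Y) → f ⨾ id→ ≡ f
    assoc     : ∀ {W X Y Z} (f : Hom W X) (g : Hom X Y) (h : Hom Y Z) →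
                (f ⨾ g) ⨾ h ≡ f ⨾ (g ⨾ h)

  -- The identity morphism, typed along an equation between objects.
  id[_] : ∀ {X Y} → X ≡ Y → Hom X Y
  id[ refl ] = id→

record FunctorOver {Obj : Set o} {Obj′ : Set o′} (F₀ : Obj → Obj′)
                   (𝐂 : CategoryOn Obj ℓ) (𝐃 : CategoryOn Obj′ ℓ′) :
                   Set (o ⊔ ℓ ⊔ ℓ′) where
  private
    module C = CategoryOn 𝐂
    module D = CategoryOn 𝐃
  field
    map    : ∀ {X Y} → C.Hom X Y → D.Hom (F₀ X) (F₀ Y)
    map-id : ∀ {X} → map (C.id→ {X}) ≡ D.id→
    map-⨾  : ∀ {X Y Z} (f : C.Hom X Y) (g : C.Hom Y Z) →
             map (f C.⨾ g) ≡ map f D.⨾ map g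

-- A monoid up to propositional equality.

record ObjMonoid o : Set (suc o) where
  infixr 7 _⊗₀_
  field
    Obj      : Set o
    _⊗₀_     : Obj → Obj → Obj
    I        : Obj
    isMonoid : Structures.IsMonoid _≡_ _⊗₀_ I

  monoid : Monoid o o
  monoid = record { isMonoid = isMonoid }

  open Monoid monoid public using (rawMonoid)
  open Structures.IsMonoid isMonoid public using ()
    renaming (assoc to ⊗₀-assoc; identityˡ to ⊗₀-identityˡ; identityʳ to ⊗₀-identityʳ)

MonoidHom : ObjMonoid o → ObjMonoid o′ → Set (o ⊔ o′)
MonoidHom 𝐌 𝐍 = MonoidHomomorphism (ObjMonoid.rawMonoid 𝐌) (ObjMonoid.rawMonoid 𝐍)

idHom : (𝐌 : ObjMonoid o) → MonoidHom 𝐌 𝐌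
idHom 𝐌 = record
  { ⟦_⟧                  = id
  ; isMonoidHomomorphism = Identity.isMonoidHomomorphism (ObjMonoid.rawMonoid 𝐌) refl
  }

infixl 6 _⨾Hom_
_⨾Hom_ : {𝐋 : ObjMonoid o} {𝐌 : ObjMonoid o′} {𝐍 : ObjMonoid o″} →
         MonoidHom 𝐋 𝐌 → MonoidHom 𝐌 𝐍 → MonoidHom 𝐋 𝐍
f ⨾Hom g = record
  { ⟦_⟧                  = MonoidHomomorphism.⟦_⟧ g ∘ MonoidHomomorphism.⟦_⟧ f
  ; isMonoidHomomorphism = Composition.isMonoidHomomorphism ≡.trans
      (MonoidHomomorphism.isMonoidHomomorphism f)
      (MonoidHomomorphism.isMonoidHomomorphism g)
  }

-- Heterogeneous equality is used exactly where the two sides are typed by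
-- objects (or grades) that are only propositionally equal.

record StrictMonoidal (𝐌 : ObjMonoid o) ℓ : Set (o ⊔ suc ℓ) where
  open ObjMonoid 𝐌
  infixr 7 _⊗_
  field
    category : CategoryOn Obj ℓ
  open CategoryOn category public
  field
    _⊗_         : ∀ {X Y X′ Y′} → Hom X Y → Hom X′ Y′ → Hom (X ⊗₀ X′) (Y ⊗₀ Y′)
    ⊗-id        : ∀ {X Y} → id→ {X} ⊗ id→ {Y} ≡ id→
    ⊗-⨾         : ∀ {X Y Z X′ Y′ Z′}
                  (f : Hom X Y) (g : Hom X′ Y′) (h : Hom Y Z) (k : Hom Y′ Z′) →
                  (f ⊗ g) ⨾ (h ⊗ k) ≡ (f ⨾ h) ⊗ (g ⨾ k)
    ⊗-identityˡ : ∀ {X Y} (f : Hom X Y) → id→ {I} ⊗ f ≅ f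
    ⊗-identityʳ : ∀ {X Y} (f : Hom X Y) → f ⊗ id→ {I} ≅ f
    ⊗-assoc     : ∀ {X Y X′ Y′ X″ Y″} (f : Hom X Y) (g : Hom X′ Y′) (h : Hom X″ Y″) →
                  (f ⊗ g) ⊗ h ≅ f ⊗ (g ⊗ h)

record Symmetric {𝐌 : ObjMonoid o} (𝐕 : StrictMonoidal 𝐌 ℓ) : Set (o ⊔ ℓ) where
  open ObjMonoid 𝐌
  open StrictMonoidal 𝐕
  field
    σ            : ∀ X Y → Hom (X ⊗₀ Y) (Y ⊗₀ X)
    σ-natural    : ∀ {X Y X′ Y′} (f : Hom X Y) (g : Hom X′ Y′) →
                   (f ⊗ g) ⨾ σ Y Y′ ≡ σ X X′ ⨾ (g ⊗ f)
    σ-involutive : ∀ X Y → σ X Y ⨾ σ Y X ≡ id→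
    σ-⊗          : ∀ X Y Z →
                   (σ X Y ⊗ id→ {Z}) ⨾ id[ ⊗₀-assoc Y X Z ] ⨾ (id→ {Y} ⊗ σ X Z) ≅ σ X (Y ⊗₀ Z)
    σ-I          : ∀ X → σ X I ≅ id→ {X}

-- The last two fields identify the braiding with the canonical one of the product.

record Cartesian {𝐌 : ObjMonoid o} {𝐕 : StrictMonoidal 𝐌 ℓ} (𝐒 : Symmetric 𝐕) :
                 Set (o ⊔ ℓ) where
  open ObjMonoid 𝐌
  open StrictMonoidal 𝐕
  open Symmetric 𝐒
  infix 8 ![_]
  field
    ![_]     : ∀ X → Hom X I
    !-unique : ∀ {X} (f : Hom X I) → f ≡ ![ X ]

  π₁ : ∀ {A B} → Hom (A ⊗₀ B) A
  π₁ {A} {B} = (id→ {A} ⊗ ![ B ]) ⨾ id[ ⊗₀-identityʳ A ]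

  π₂ : ∀ {A B} → Hom (A ⊗₀ B) B
  π₂ {A} {B} = (![ A ] ⊗ id→ {B}) ⨾ id[ ⊗₀-identityˡ B ]

  field
    ⟨_,_⟩    : ∀ {X A B} → Hom X A → Hom X B → Hom X (A ⊗₀ B)
    project₁ : ∀ {X A B} (f : Hom X A) (g : Hom X B) → ⟨ f , g ⟩ ⨾ π₁ ≡ f
    project₂ : ∀ {X A B} (f : Hom X A) (g : Hom X B) → ⟨ f , g ⟩ ⨾ π₂ ≡ g
    unique   : ∀ {X A B} (f : Hom X A) (g : Hom X B) (h : Hom X (A ⊗₀ B)) →
               h ⨾ π₁ ≡ f → h ⨾ π₂ ≡ g → h ≡ ⟨ f , g ⟩
    σ-π₁     : ∀ A B → σ A B ⨾ π₁ ≡ π₂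
    σ-π₂     : ∀ A B → σ A B ⨾ π₂ ≡ π₁

-- A cartesian monoidal functor is a strict monoidal functor between cartesian
-- monoidal categories; no preservation of the chosen pairings is imposed.

record IsStrictMonoidalFunctor
         {𝐌 : ObjMonoid o} {𝐍 : ObjMonoid o′}
         (𝐕 : StrictMonoidal 𝐌 ℓ) (𝐖 : StrictMonoidal 𝐍 ℓ′) (h : MonoidHom 𝐌 𝐍)
         (F : FunctorOver (MonoidHomomorphism.⟦_⟧ h)
                (StrictMonoidal.category 𝐕) (StrictMonoidal.category 𝐖)) :
         Set (o ⊔ ℓ ⊔ ℓ′) where
  private
    module V = StrictMonoidal 𝐕
    module W = StrictMonoidal 𝐖
  open FunctorOver F
  field
    ⊗-homo : ∀ {X Y X′ Y′} (f : V.Hom X Y) (g : V.Hom X′ Y′) →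
             map (f V.⊗ g) ≅ map f W.⊗ map g

record StrictPremonoidal (𝐌 : ObjMonoid o) ℓ : Set (o ⊔ suc ℓ) where
  open ObjMonoid 𝐌
  infixr 7 _⋉_
  infixl 7 _⋊_
  field
    category : CategoryOn Obj ℓ
  open CategoryOn category public
  field
    leftWhisker  : ∀ A → FunctorOver (λ B → A ⊗₀ B) category category
    rightWhisker : ∀ A → FunctorOver (λ B → B ⊗₀ A) category category

  _⋉_ : ∀ A {X Y} → Hom X Y → Hom (A ⊗₀ X) (A ⊗₀ Y)
  A ⋉ f = FunctorOver.map (leftWhisker A) f

  _⋊_ : ∀ {X Y} → Hom X Y → ∀ A → Hom (X ⊗₀ A) (Y ⊗₀ A)
  f ⋊ A = FunctorOver.map (rightWhisker A) f

  field
    ⋉-⋊-assoc  : ∀ A B {X Y} (f : Hom X Y) → (A ⋉ f) ⋊ B ≅ A ⋉ (f ⋊ B)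
    ⋉-⊗₀       : ∀ A B {X Y} (f : Hom X Y) → (A ⊗₀ B) ⋉ f ≅ A ⋉ (B ⋉ f)
    ⋊-⊗₀       : ∀ A B {X Y} (f : Hom X Y) → f ⋊ (A ⊗₀ B) ≅ (f ⋊ A) ⋊ B
    ⋉-identity : ∀ {X Y} (f : Hom X Y) → I ⋉ f ≅ f
    ⋊-identity : ∀ {X Y} (f : Hom X Y) → f ⋊ I ≅ f

  Central : ∀ {A B} → Hom A B → Set (o ⊔ ℓ)
  Central {A} {B} f = ∀ {C D} (g : Hom C D) →
    ((A ⋉ g) ⨾ (f ⋊ D) ≡ (f ⋊ C) ⨾ (B ⋉ g)) ×
    ((g ⋊ A) ⨾ (D ⋉ f) ≡ (C ⋉ f) ⨾ (g ⋊ B))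

record SymmetricPremonoidal {𝐌 : ObjMonoid o} (𝐂 : StrictPremonoidal 𝐌 ℓ) :
                            Set (o ⊔ ℓ) where
  open ObjMonoid 𝐌
  open StrictPremonoidal 𝐂
  field
    σ            : ∀ X Y → Hom (X ⊗₀ Y) (Y ⊗₀ X)
    σ-central    : ∀ X Y → Central (σ X Y)
    σ-naturalˡ   : ∀ {X Y} (f : Hom X Y) Z → (f ⋊ Z) ⨾ σ Y Z ≡ σ X Z ⨾ (Z ⋉ f)
    σ-naturalʳ   : ∀ {X Y} (f : Hom X Y) Z → (Z ⋉ f) ⨾ σ Z Y ≡ σ Z X ⨾ (f ⋊ Z)
    σ-involutive : ∀ X Y → σ X Y ⨾ σ Y X ≡ id→
    σ-⊗          : ∀ X Y Z →
                   (σ X Y ⋊ Z) ⨾ id[ ⊗₀-assoc Y X Z ] ⨾ (Y ⋉ σ X Z) ≅ σ X (Y ⊗₀ Z)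
    σ-I          : ∀ X → σ X I ≅ id→ {X}

record IsStrictPremonoidalFunctor
         {𝐌 : ObjMonoid o} {𝐍 : ObjMonoid o′}
         (𝐂 : StrictPremonoidal 𝐌 ℓ) (𝐃 : StrictPremonoidal 𝐍 ℓ′) (h : MonoidHom 𝐌 𝐍)
         (F : FunctorOver (MonoidHomomorphism.⟦_⟧ h)
                (StrictPremonoidal.category 𝐂) (StrictPremonoidal.category 𝐃)) :
         Set (o ⊔ ℓ ⊔ ℓ′) where
  private
    module C = StrictPremonoidal 𝐂
    module D = StrictPremonoidal 𝐃
  open MonoidHomomorphism h using (⟦_⟧)
  open FunctorOver F
  field
    ⋉-homo : ∀ A {X Y} (f : C.Hom X Y) → map (A C.⋉ f) ≅ ⟦ A ⟧ D.⋉ map f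
    ⋊-homo : ∀ {X Y} (f : C.Hom X Y) A → map (f C.⋊ A) ≅ map f D.⋊ ⟦ A ⟧

premonoidal : {𝐌 : ObjMonoid o} → StrictMonoidal 𝐌 ℓ → StrictPremonoidal 𝐌 ℓ
premonoidal {𝐌 = 𝐌} 𝐕 = record
  { category     = category
  ; leftWhisker  = λ A → record
    { map    = id→ {A} ⊗_
    ; map-id = ⊗-id
    ; map-⨾  = λ f g → ≡.trans (≡.cong (_⊗ (f ⨾ g)) (≡.sym (identityˡ id→)))
                               (≡.sym (⊗-⨾ id→ f id→ g))
    }
  ; rightWhisker = λ A → record
    { map    = _⊗ id→ {A}
    ; map-id = ⊗-id
    ; map-⨾  = λ f g → ≡.trans (≡.cong ((f ⨾ g) ⊗_) (≡.sym (identityˡ id→)))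
                               (≡.sym (⊗-⨾ f id→ g id→))
    }
  ; ⋉-⋊-assoc    = λ A B f → ⊗-assoc id→ f id→
  ; ⋉-⊗₀         = λ A B f → ≅.trans (≡-to-≅ (≡.cong (_⊗ f) (≡.sym ⊗-id))) (⊗-assoc id→ id→ f)
  ; ⋊-⊗₀         = λ A B f → ≅.trans (≡-to-≅ (≡.cong (f ⊗_) (≡.sym ⊗-id)))
                                     (≅.sym (⊗-assoc f id→ id→))
  ; ⋉-identity   = ⊗-identityˡ
  ; ⋊-identity   = ⊗-identityʳ
  }
  where open StrictMonoidal 𝐕

record SymmetricEffectful o ℓ : Set (suc (o ⊔ ℓ)) where
  field
    objects     : ObjMonoid o
    𝕍           : StrictMonoidal objects ℓ
    𝕍-symmetric : Symmetric 𝕍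
    ℂ           : StrictPremonoidal objects ℓ
    ℂ-symmetric : SymmetricPremonoidal ℂ

  open ObjMonoid objects public
  module V = StrictMonoidal 𝕍
  module VS = Symmetric 𝕍-symmetric
  module C = StrictPremonoidal ℂ
  module CS = SymmetricPremonoidal ℂ-symmetric

  field
    η               : FunctorOver id V.category C.category
    η-premonoidal   : IsStrictPremonoidalFunctor (premonoidal 𝕍) ℂ (idHom objects) η
    η-σ             : ∀ X Y → FunctorOver.map η (VS.σ X Y) ≡ CS.σ X Y
    η-central       : ∀ {X Y} (f : V.Hom X Y) → C.Central (FunctorOver.map η f)

record FreydCategory o ℓ : Set (suc (o ⊔ ℓ)) where
  field
    effectful : SymmetricEffectful o ℓ
  open SymmetricEffectful effectful public
  field
    𝕍-cartesian : Cartesian 𝕍-symmetric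

-- The equation F₁ ∘ η = η′ ∘ F₀ forces both functors to have the same action on
-- objects, which is recorded once.

record FreydFunctor (𝐀 : FreydCategory o ℓ) (𝐁 : FreydCategory o′ ℓ′) :
                    Set (o ⊔ ℓ ⊔ o′ ⊔ ℓ′) where
  private
    module A = FreydCategory 𝐀
    module B = FreydCategory 𝐁
  field
    onObjects : MonoidHom A.objects B.objects
  open MonoidHomomorphism onObjects public using (⟦_⟧)
  field
    F₀            : FunctorOver ⟦_⟧ A.V.category B.V.category
    F₁            : FunctorOver ⟦_⟧ A.C.category B.C.category
  module F₀ = FunctorOver F₀
  module F₁ = FunctorOver F₁
  field
    F₀-cartesian   : IsStrictMonoidalFunctor A.𝕍 B.𝕍 onObjects F₀
    F₀-σ           : ∀ X Y → F₀.map (A.VS.σ X Y) ≅ B.VS.σ ⟦ X ⟧ ⟦ Y ⟧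
    F₁-premonoidal : IsStrictPremonoidalFunctor A.ℂ B.ℂ onObjects F₁
    F₁-σ           : ∀ X Y → F₁.map (A.CS.σ X Y) ≅ B.CS.σ ⟦ X ⟧ ⟦ Y ⟧
    F₁-η           : ∀ {X Y} (f : A.V.Hom X Y) →
                     F₁.map (FunctorOver.map A.η f) ≡ FunctorOver.map B.η (F₀.map f)

-- Regrading takes a witness of a ⩽ b, but regrade-refl and regrade-trans
-- together make it independent of the witness.  Likewise tensor takes a proof
-- that a ⊕ b is defined with value c; such proofs are unique.

record GradedMonoidal (𝐄 : PCM e) o ℓ : Set (e ⊔ suc (o ⊔ ℓ)) where
  private
    module E = PCM 𝐄
  open E using (_⊕_↦_; _⩽_; 𝟘) renaming (Carrier to E)
  field
    objects  : ObjMonoid o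
  open ObjMonoid objects public
  field
    category : E → CategoryOn Obj ℓ

  Hom : E → Obj → Obj → Set ℓ
  Hom a = CategoryOn.Hom (category a)

  infixl 6 _⨾_
  _⨾_ : ∀ {a X Y Z} → Hom a X Y → Hom a Y Z → Hom a X Z
  _⨾_ {a} = CategoryOn._⨾_ (category a)

  id₀ : ∀ {X} → Hom 𝟘 X X
  id₀ = CategoryOn.id→ (category 𝟘)

  field
    regrading : ∀ {a b} → a ⩽ b → FunctorOver id (category a) (category b)
    tensor    : ∀ {a b c} → a ⊕ b ↦ c → ∀ {X Y X′ Y′} →
                Hom a X Y → Hom b X′ Y′ → Hom c (X ⊗₀ X′) (Y ⊗₀ Y′)

  regrade : ∀ {a b} → a ⩽ b → ∀ {X Y} → Hom a X Y → Hom b X Y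
  regrade p = FunctorOver.map (regrading p)

  field
    regrade-refl     : ∀ {a} (p : a ⩽ a) {X Y} (f : Hom a X Y) → regrade p f ≡ f
    regrade-trans    : ∀ {a b c} (p : a ⩽ b) (q : b ⩽ c) (r : a ⩽ c) {X Y} (f : Hom a X Y) →
                       regrade q (regrade p f) ≡ regrade r f
    regrade-tensor   : ∀ {a b c d m n} (p : a ⊕ b ↦ m) (q : c ⊕ d ↦ n)
                       (r : a ⩽ c) (s : b ⩽ d) (t : m ⩽ n)
                       {X Y X′ Y′} (f : Hom a X Y) (g : Hom b X′ Y′) →
                       regrade t (tensor p f g) ≡ tensor q (regrade r f) (regrade s g)
    tensor-identityˡ : ∀ {a X Y} (f : Hom a X Y) → tensor (E.identityˡ a) (id₀ {I}) f ≅ f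
    tensor-identityʳ : ∀ {a X Y} (f : Hom a X Y) → tensor (E.identityʳ a) f (id₀ {I}) ≅ f
    tensor-assoc     : ∀ {a b c m n k} (p : a ⊕ b ↦ m) (q : m ⊕ c ↦ k)
                       (r : b ⊕ c ↦ n) (s : a ⊕ n ↦ k)
                       {X Y X′ Y′ X″ Y″} (f : Hom a X Y) (g : Hom b X′ Y′) (h : Hom c X″ Y″) →
                       tensor q (tensor p f g) h ≅ tensor s f (tensor r g h)
    tensor-id        : ∀ {X Y} → tensor (E.identityʳ 𝟘) (id₀ {X}) (id₀ {Y}) ≡ id₀
    tensor-⨾         : ∀ {a b c} (p : a ⊕ b ↦ c) {X Y Z X′ Y′ Z′}
                       (f : Hom a X Y) (g : Hom b X′ Y′) (h : Hom a Y Z) (k : Hom b Y′ Z′) →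
                       tensor p f g ⨾ tensor p h k ≡ tensor p (f ⨾ h) (g ⨾ k)

  pureMonoidal : StrictMonoidal objects ℓ
  pureMonoidal = record
    { category    = category 𝟘
    ; _⊗_         = tensor (E.identityʳ 𝟘)
    ; ⊗-id        = tensor-id
    ; ⊗-⨾         = tensor-⨾ (E.identityʳ 𝟘)
    ; ⊗-identityˡ = λ f → ≅.trans
        (≡-to-≅ (≡.cong (λ p → tensor p id₀ f) (≡-irrelevant (E.identityʳ 𝟘) (E.identityˡ 𝟘))))
        (tensor-identityˡ f)
    ; ⊗-identityʳ = tensor-identityʳ
    ; ⊗-assoc     = tensor-assoc _ _ _ _
    }
    where
    ≡-irrelevant : ∀ {A : Set e} {x y : A} (p q : x ≡ y) → p ≡ q
    ≡-irrelevant refl refl = refl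

record SymmetricGraded {𝐄 : PCM e} (𝐂 : GradedMonoidal 𝐄 o ℓ) : Set (e ⊔ o ⊔ ℓ) where
  open PCM 𝐄 using (_⊕_↦_; 𝟘⩽)
  open GradedMonoidal 𝐂
  field
    pureSymmetric : Symmetric pureMonoidal
  open Symmetric pureSymmetric public
  field
    σ-natural-graded : ∀ {a b c} (p : a ⊕ b ↦ c) (q : b ⊕ a ↦ c)
                       {X Y X′ Y′} (f : Hom a X Y) (g : Hom b X′ Y′) →
                       tensor p f g ⨾ regrade (𝟘⩽ c) (σ Y Y′) ≡
                       regrade (𝟘⩽ c) (σ X X′) ⨾ tensor q g f

record CartesianGraded (𝐄 : PCM e) o ℓ : Set (e ⊔ suc (o ⊔ ℓ)) where
  field
    graded    : GradedMonoidal 𝐄 o ℓ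
    symmetric : SymmetricGraded graded
    cartesian : Cartesian (SymmetricGraded.pureSymmetric symmetric)
  open GradedMonoidal graded public

record GradedFunctor {𝐄 : PCM e} (𝐂 : CartesianGraded 𝐄 o ℓ) (𝐃 : CartesianGraded 𝐄 o′ ℓ′) :
                     Set (e ⊔ o ⊔ ℓ ⊔ o′ ⊔ ℓ′) where
  open PCM 𝐄 using (_⊕_↦_; _⩽_; 𝟘)
  private
    module C = CartesianGraded 𝐂
    module D = CartesianGraded 𝐃
  field
    onObjects : MonoidHom C.objects D.objects
  open MonoidHomomorphism onObjects public using (⟦_⟧)
  field
    functor   : ∀ a → FunctorOver ⟦_⟧ (C.category a) (D.category a)

  map : ∀ {a X Y} → C.Hom a X Y → D.Hom a ⟦ X ⟧ ⟦ Y ⟧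
  map {a} = FunctorOver.map (functor a)

  field
    tensor-homo    : ∀ {a b c} (p : a ⊕ b ↦ c) {X Y X′ Y′} (g : C.Hom a X Y) (h : C.Hom b X′ Y′) →
                     map (C.tensor p g h) ≅ D.tensor p (map g) (map h)
    regrade-homo   : ∀ {a b} (p : a ⩽ b) {X Y} (g : C.Hom a X Y) →
                     map (C.regrade p g) ≡ D.regrade p (map g)
    pure-cartesian : IsStrictMonoidalFunctor C.pureMonoidal D.pureMonoidal onObjects (functor 𝟘)

map-≅ : {Obj : Set o} {Obj′ : Set o′} {𝐂 : CategoryOn Obj ℓ} {𝐃 : CategoryOn Obj′ ℓ′}
        {F₀ : Obj → Obj′} (F : FunctorOver F₀ 𝐂 𝐃)
        {X X′ Y Y′ : Obj} {f : CategoryOn.Hom 𝐂 X Y} {f′ : CategoryOn.Hom 𝐂 X′ Y′} → X ≡ X′ → Y ≡ Y′ → f ≅ f′ →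
        FunctorOver.map F f ≅ FunctorOver.map F f′
map-≅ F refl refl refl = refl

idFunctor : {Obj : Set o} {𝐂 : CategoryOn Obj ℓ} → FunctorOver id 𝐂 𝐂
idFunctor = record { map = id ; map-id = refl ; map-⨾ = λ _ _ → refl }

infixl 6 _⨾Functor_
_⨾Functor_ : {Obj : Set o} {Obj′ : Set o′} {Obj″ : Set o″}
             {𝐂 : CategoryOn Obj ℓ} {𝐃 : CategoryOn Obj′ ℓ′} {𝐄 : CategoryOn Obj″ ℓ″}
             {F₀ : Obj → Obj′} {G₀ : Obj′ → Obj″} →
             FunctorOver F₀ 𝐂 𝐃 → FunctorOver G₀ 𝐃 𝐄 → FunctorOver (G₀ ∘ F₀) 𝐂 𝐄
F ⨾Functor G = record
  { map    = G.map ∘ F.map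
  ; map-id = ≡.trans (≡.cong G.map F.map-id) G.map-id
  ; map-⨾  = λ f g → ≡.trans (≡.cong G.map (F.map-⨾ f g)) (G.map-⨾ (F.map f) (F.map g))
  }
  where
  module F = FunctorOver F
  module G = FunctorOver G


infix 4 _≈Freyd_
record _≈Freyd_ {𝐀 : FreydCategory o ℓ} {𝐁 : FreydCategory o′ ℓ′} (F G : FreydFunctor 𝐀 𝐁) :
                Set (o ⊔ ℓ ⊔ o′ ⊔ ℓ′) where
  private
    module A = FreydCategory 𝐀
    module F = FreydFunctor F
    module G = FreydFunctor G
  field
    ≈-objects : ∀ X → F.⟦ X ⟧ ≡ G.⟦ X ⟧
    ≈-F₀      : ∀ {X Y} (f : A.V.Hom X Y) → F.F₀.map f ≅ G.F₀.map f
    ≈-F₁      : ∀ {X Y} (f : A.C.Hom X Y) → F.F₁.map f ≅ G.F₁.map f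

infix 4 _≈Graded_
record _≈Graded_ {𝐄 : PCM e} {𝐂 : CartesianGraded 𝐄 o ℓ} {𝐃 : CartesianGraded 𝐄 o′ ℓ′}
                 (F G : GradedFunctor 𝐂 𝐃) : Set (e ⊔ o ⊔ ℓ ⊔ o′ ⊔ ℓ′) where
  private
    module C = CartesianGraded 𝐂
    module F = GradedFunctor F
    module G = GradedFunctor G
  field
    ≈-objects : ∀ X → F.⟦ X ⟧ ≡ G.⟦ X ⟧
    ≈-map     : ∀ {a X Y} (f : C.Hom a X Y) → F.map f ≅ G.map f

-- Large categories, with propositional equality of objects and a setoid of
-- morphisms.

record Category o ℓ r : Set (suc (o ⊔ ℓ ⊔ r)) where
  infix  4 _≈_ _⇒_
  infixl 6 _⨾_
  field
    Obj           : Set o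
    _⇒_           : Obj → Obj → Set ℓ
    _≈_           : ∀ {A B} → A ⇒ B → A ⇒ B → Set r
    id→           : ∀ {A} → A ⇒ A
    _⨾_           : ∀ {A B C} → A ⇒ B → B ⇒ C → A ⇒ C
    isEquivalence : ∀ {A B} → IsEquivalence (_≈_ {A} {B})
    ⨾-cong        : ∀ {A B C} {f f′ : A ⇒ B} {g g′ : B ⇒ C} → f ≈ f′ → g ≈ g′ → f ⨾ g ≈ f′ ⨾ g′
    identityˡ     : ∀ {A B} (f : A ⇒ B) → id→ ⨾ f ≈ f
    identityʳ     : ∀ {A B} (f : A ⇒ B) → f ⨾ id→ ≈ f
    assoc         : ∀ {A B C D} (f : A ⇒ B) (g : B ⇒ C) (h : C ⇒ D) → (f ⨾ g) ⨾ h ≈ f ⨾ (g ⨾ h)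

record Functor (𝒞 : Category o ℓ r) (𝒟 : Category o′ ℓ′ r′) :
               Set (o ⊔ ℓ ⊔ r ⊔ o′ ⊔ ℓ′ ⊔ r′) where
  private
    module C = Category 𝒞
    module D = Category 𝒟
  field
    obj      : C.Obj → D.Obj
    map      : ∀ {A B} → A C.⇒ B → obj A D.⇒ obj B
    map-cong : ∀ {A B} {f g : A C.⇒ B} → f C.≈ g → map f D.≈ map g
    map-id   : ∀ {A} → map (C.id→ {A}) D.≈ D.id→
    map-⨾    : ∀ {A B C} (f : A C.⇒ B) (g : B C.⇒ C) → map (f C.⨾ g) D.≈ map f D.⨾ map g

-- G after F is the identity functor, on objects and on morphisms.

record IsLeftInverse {𝒞 : Category o ℓ r} {𝒟 : Category o′ ℓ′ r′}
                     (G : Functor 𝒟 𝒞) (F : Functor 𝒞 𝒟) : Set (o ⊔ ℓ ⊔ r) where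
  open Category 𝒞
  private
    module F = Functor F
    module G = Functor G
  field
    obj-inverse : ∀ A → G.obj (F.obj A) ≡ A
    map-inverse : ∀ {A B} (f : A ⇒ B) →
                  subst₂ _⇒_ (obj-inverse A) (obj-inverse B) (G.map (F.map f)) ≈ f

record Isomorphism (𝒞 : Category o ℓ r) (𝒟 : Category o′ ℓ′ r′) :
                   Set (o ⊔ ℓ ⊔ r ⊔ o′ ⊔ ℓ′ ⊔ r′) where
  field
    to      : Functor 𝒞 𝒟
    from    : Functor 𝒟 𝒞
    from∘to : IsLeftInverse from to
    to∘from : IsLeftInverse to from

Freyd : ∀ o ℓ → Category (suc (o ⊔ ℓ)) (o ⊔ ℓ) (o ⊔ ℓ)
Freyd o ℓ = record
  { Obj           = FreydCategory o ℓ
  ; _⇒_           = FreydFunctor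
  ; _≈_           = _≈Freyd_
  ; id→           = λ {𝐀} → record
    { onObjects      = idHom (FreydCategory.objects 𝐀)
    ; F₀             = idFunctor
    ; F₁             = idFunctor
    ; F₀-cartesian   = record { ⊗-homo = λ _ _ → refl }
    ; F₀-σ           = λ _ _ → refl
    ; F₁-premonoidal = record { ⋉-homo = λ _ _ → refl ; ⋊-homo = λ _ _ → refl }
    ; F₁-σ           = λ _ _ → refl
    ; F₁-η           = λ _ → refl
    }
  ; _⨾_           = _⨾Freyd_
  ; isEquivalence = record { refl = ≈-refl ; sym = ≈-sym ; trans = ≈-trans }
  ; ⨾-cong        = ≈-cong
  ; identityˡ     = λ _ → record
      { ≈-objects = λ _ → refl ; ≈-F₀ = λ _ → refl ; ≈-F₁ = λ _ → refl }
  ; identityʳ     = λ _ → record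
      { ≈-objects = λ _ → refl ; ≈-F₀ = λ _ → refl ; ≈-F₁ = λ _ → refl }
  ; assoc         = λ _ _ _ → record
      { ≈-objects = λ _ → refl ; ≈-F₀ = λ _ → refl ; ≈-F₁ = λ _ → refl }
  }
  where
  _⨾Freyd_ : {𝐀 𝐁 𝐂 : FreydCategory o ℓ} →
             FreydFunctor 𝐀 𝐁 → FreydFunctor 𝐁 𝐂 → FreydFunctor 𝐀 𝐂
  _⨾Freyd_ {𝐀} {𝐁} {𝐂} F G = record
    { onObjects      = _⨾Hom_ {𝐋 = A.objects} {𝐌 = B.objects} {𝐍 = C.objects}
                         F.onObjects G.onObjects
    ; F₀             = F.F₀ ⨾Functor G.F₀
    ; F₁             = F.F₁ ⨾Functor G.F₁
    ; F₀-cartesian   = record { ⊗-homo = λ f g → ≅.trans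
        (map-≅ G.F₀ (F.homo _ _) (F.homo _ _) (F.F₀-cartesian.⊗-homo f g))
        (G.F₀-cartesian.⊗-homo _ _) }
    ; F₀-σ           = λ X Y → ≅.trans
        (map-≅ G.F₀ (F.homo X Y) (F.homo Y X) (F.F₀-σ X Y)) (G.F₀-σ _ _)
    ; F₁-premonoidal = record
      { ⋉-homo = λ A f → ≅.trans
          (map-≅ G.F₁ (F.homo A _) (F.homo A _) (F.F₁-premonoidal.⋉-homo A f))
          (G.F₁-premonoidal.⋉-homo _ _)
      ; ⋊-homo = λ f A → ≅.trans
          (map-≅ G.F₁ (F.homo _ A) (F.homo _ A) (F.F₁-premonoidal.⋊-homo f A))
          (G.F₁-premonoidal.⋊-homo _ _)
      }
    ; F₁-σ           = λ X Y → ≅.trans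
        (map-≅ G.F₁ (F.homo X Y) (F.homo Y X) (F.F₁-σ X Y)) (G.F₁-σ _ _)
    ; F₁-η           = λ f → ≡.trans (≡.cong G.F₁.map (F.F₁-η f)) (G.F₁-η _)
    }
    where
    module A = FreydCategory 𝐀
    module B = FreydCategory 𝐁
    module C = FreydCategory 𝐂
    module F where
      open FreydFunctor F public
      open MonoidHomomorphism onObjects public using (homo)
      module F₀-cartesian = IsStrictMonoidalFunctor F₀-cartesian
      module F₁-premonoidal = IsStrictPremonoidalFunctor F₁-premonoidal
    module G where
      open FreydFunctor G public
      module F₀-cartesian = IsStrictMonoidalFunctor F₀-cartesian
      module F₁-premonoidal = IsStrictPremonoidalFunctor F₁-premonoidal

  ≈-refl : {𝐀 𝐁 : FreydCategory o ℓ} {F : FreydFunctor 𝐀 𝐁} → F ≈Freyd F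
  ≈-refl = record { ≈-objects = λ _ → refl ; ≈-F₀ = λ _ → refl ; ≈-F₁ = λ _ → refl }

  ≈-sym : {𝐀 𝐁 : FreydCategory o ℓ} {F G : FreydFunctor 𝐀 𝐁} → F ≈Freyd G → G ≈Freyd F
  ≈-sym p = record
    { ≈-objects = λ X → ≡.sym (p.≈-objects X)
    ; ≈-F₀      = λ f → ≅.sym (p.≈-F₀ f)
    ; ≈-F₁      = λ f → ≅.sym (p.≈-F₁ f)
    }
    where module p = _≈Freyd_ p

  ≈-trans : {𝐀 𝐁 : FreydCategory o ℓ} {F G H : FreydFunctor 𝐀 𝐁} →
            F ≈Freyd G → G ≈Freyd H → F ≈Freyd H
  ≈-trans p q = record
    { ≈-objects = λ X → ≡.trans (p.≈-objects X) (q.≈-objects X)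
    ; ≈-F₀      = λ f → ≅.trans (p.≈-F₀ f) (q.≈-F₀ f)
    ; ≈-F₁      = λ f → ≅.trans (p.≈-F₁ f) (q.≈-F₁ f)
    }
    where
    module p = _≈Freyd_ p
    module q = _≈Freyd_ q

  ≈-cong : {𝐀 𝐁 𝐂 : FreydCategory o ℓ} {F F′ : FreydFunctor 𝐀 𝐁} {G G′ : FreydFunctor 𝐁 𝐂} →
           F ≈Freyd F′ → G ≈Freyd G′ → (F ⨾Freyd G) ≈Freyd (F′ ⨾Freyd G′)
  ≈-cong {F′ = F′} {G = G} p q = record
    { ≈-objects = λ X → ≡.trans (≡.cong G.⟦_⟧ (p.≈-objects X)) (q.≈-objects F′.⟦ X ⟧)
    ; ≈-F₀      = λ {X} {Y} f → ≅.trans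
        (map-≅ G.F₀ (p.≈-objects X) (p.≈-objects Y) (p.≈-F₀ f)) (q.≈-F₀ (F′.F₀.map f))
    ; ≈-F₁      = λ {X} {Y} f → ≅.trans
        (map-≅ G.F₁ (p.≈-objects X) (p.≈-objects Y) (p.≈-F₁ f)) (q.≈-F₁ (F′.F₁.map f))
    }
    where
    module p = _≈Freyd_ p
    module q = _≈Freyd_ q
    module F′ = FreydFunctor F′
    module G = FreydFunctor G

Cart_-GradMon : PCM e → ∀ o ℓ → Category (e ⊔ suc (o ⊔ ℓ)) (e ⊔ o ⊔ ℓ) (e ⊔ o ⊔ ℓ)
Cart_-GradMon {e = e} 𝐄 o ℓ = record
  { Obj           = CartesianGraded 𝐄 o ℓ
  ; _⇒_           = GradedFunctor
  ; _≈_           = _≈Graded_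
  ; id→           = λ {𝐂} → record
    { onObjects      = idHom (CartesianGraded.objects 𝐂)
    ; functor        = λ _ → idFunctor
    ; tensor-homo    = λ _ _ _ → refl
    ; regrade-homo   = λ _ _ → refl
    ; pure-cartesian = record { ⊗-homo = λ _ _ → refl }
    }
  ; _⨾_           = _⨾Graded_
  ; isEquivalence = record { refl = ≈-refl ; sym = ≈-sym ; trans = ≈-trans }
  ; ⨾-cong        = ≈-cong
  ; identityˡ     = λ _ → record { ≈-objects = λ _ → refl ; ≈-map = λ _ → refl }
  ; identityʳ     = λ _ → record { ≈-objects = λ _ → refl ; ≈-map = λ _ → refl }
  ; assoc         = λ _ _ _ → record { ≈-objects = λ _ → refl ; ≈-map = λ _ → refl }
  }
  where
  _⨾Graded_ : {𝐀 𝐁 𝐂 : CartesianGraded 𝐄 o ℓ} →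
              GradedFunctor 𝐀 𝐁 → GradedFunctor 𝐁 𝐂 → GradedFunctor 𝐀 𝐂
  _⨾Graded_ {𝐀} {𝐁} {𝐂} F G = record
    { onObjects      = _⨾Hom_ {𝐋 = A.objects} {𝐌 = B.objects} {𝐍 = C.objects}
                         F.onObjects G.onObjects
    ; functor        = λ a → F.functor a ⨾Functor G.functor a
    ; tensor-homo    = λ p g h → ≅.trans
        (map-≅ (G.functor _) (F.homo _ _) (F.homo _ _) (F.tensor-homo p g h))
        (G.tensor-homo p _ _)
    ; regrade-homo   = λ p g → ≡.trans (≡.cong G.map (F.regrade-homo p g)) (G.regrade-homo p _)
    ; pure-cartesian = record { ⊗-homo = λ f g → ≅.trans
        (map-≅ (G.functor _) (F.homo _ _) (F.homo _ _) (F.pure-cartesian.⊗-homo f g))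
        (G.pure-cartesian.⊗-homo _ _) }
    }
    where
    module A = CartesianGraded 𝐀
    module B = CartesianGraded 𝐁
    module C = CartesianGraded 𝐂
    module F where
      open GradedFunctor F public
      open MonoidHomomorphism onObjects public using (homo)
      module pure-cartesian = IsStrictMonoidalFunctor pure-cartesian
    module G where
      open GradedFunctor G public
      module pure-cartesian = IsStrictMonoidalFunctor pure-cartesian

  ≈-refl : {𝐀 𝐁 : CartesianGraded 𝐄 o ℓ} {F : GradedFunctor 𝐀 𝐁} → F ≈Graded F
  ≈-refl = record { ≈-objects = λ _ → refl ; ≈-map = λ _ → refl }

  ≈-sym : {𝐀 𝐁 : CartesianGraded 𝐄 o ℓ} {F G : GradedFunctor 𝐀 𝐁} → F ≈Graded G → G ≈Graded F
  ≈-sym p = record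
    { ≈-objects = λ X → ≡.sym (p.≈-objects X)
    ; ≈-map     = λ f → ≅.sym (p.≈-map f)
    }
    where module p = _≈Graded_ p

  ≈-trans : {𝐀 𝐁 : CartesianGraded 𝐄 o ℓ} {F G H : GradedFunctor 𝐀 𝐁} →
            F ≈Graded G → G ≈Graded H → F ≈Graded H
  ≈-trans p q = record
    { ≈-objects = λ X → ≡.trans (p.≈-objects X) (q.≈-objects X)
    ; ≈-map     = λ f → ≅.trans (p.≈-map f) (q.≈-map f)
    }
    where
    module p = _≈Graded_ p
    module q = _≈Graded_ q

  ≈-cong : {𝐀 𝐁 𝐂 : CartesianGraded 𝐄 o ℓ} {F F′ : GradedFunctor 𝐀 𝐁} {G G′ : GradedFunctor 𝐁 𝐂} →
           F ≈Graded F′ → G ≈Graded G′ → (F ⨾Graded G) ≈Graded (F′ ⨾Graded G′)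
  ≈-cong {F′ = F′} {G = G} p q = record
    { ≈-objects = λ X → ≡.trans (≡.cong G.⟦_⟧ (p.≈-objects X)) (q.≈-objects F′.⟦ X ⟧)
    ; ≈-map     = λ {a} {X} {Y} f → ≅.trans
        (map-≅ (G.functor a) (p.≈-objects X) (p.≈-objects Y) (p.≈-map f)) (q.≈-map (F′.map f))
    }
    where
    module p = _≈Graded_ p
    module q = _≈Graded_ q
    module F′ = GradedFunctor F′
    module G = GradedFunctor G

{-# OPTIONS --safe #-}
-- The pure category is grade zero and the effectful one is grade one, with η as regrading.
-- Since 1 ⊕ 1 is undefined, every graded tensor has a pure factor: it is whiskering on both
-- sides in either order, and the interchange law for it says exactly that pure morphisms are
-- central.  Conversely, whiskering is the graded tensor with a pure identity.  A graded functor
-- preserves the braidings because it preserves the projections that determine them.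
module Submission where

open import Algebra.Morphism.Bundles using (MonoidHomomorphism)
open import Axiom.Extensionality.Propositional
  using (Extensionality; ExtensionalityImplicit; implicit-extensionality; lower-extensionality)
open import Data.Product.Base using (_×_; _,_; proj₁; proj₂)
open import Function.Base using (id)
open import Level using (Level; suc; _⊔_)
open import Relation.Binary.HeterogeneousEquality as ≅ using (_≅_; refl; ≡-to-≅; ≅-to-≡)
open import Relation.Binary.PropositionalEquality as ≡ using (_≡_; refl)
open import Relation.Nullary.Irrelevant using (Irrelevant)
open import Defs

-- The theorem asks for round trips that return equal objects, not merely isomorphic ones, and this
-- shapes the proof: two structures have to be identified as records, laws included. Uniqueness of
-- identity proofs and function extensionality make the laws proof-irrelevant, so only data remain
-- to be compared. Most data return definitionally. The exceptions are the whiskerings and the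
-- braiding of `ℂ` on the Freyd side, and on the graded side the family of categories as a function
-- of the grade, the regradings from a grade to itself and the tensors with an effectful factor.
-- Transport along the resulting equations does not compute, so functors are compared
-- heterogeneously.

private
  variable
    o ℓ o′ ℓ′ : Level

-- Strict categories and sequential tensors

module CategoryProperties {Obj : Set o} (𝐂 : CategoryOn Obj ℓ) where
  open CategoryOn 𝐂

  -- The object equations are hypotheses between variables so that they can be matched; at the uses
  -- they are instances of associativity of `⊗₀` or of `homo`, where matching would get stuck.
  ⨾-≅ : ∀ {X X′ Y Y′ Z Z′} {f : Hom X Y} {f′ : Hom X′ Y′} {g : Hom Y Z} {g′ : Hom Y′ Z′} →
        X ≡ X′ → Y ≡ Y′ → Z ≡ Z′ → f ≅ f′ → g ≅ g′ → f ⨾ g ≅ f′ ⨾ g′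
  ⨾-≅ refl refl refl refl refl = refl

  ⨾-id[] : ∀ {X Y Z} (f : Hom X Y) (p : Y ≡ Z) → f ⨾ id[ p ] ≅ f
  ⨾-id[] f refl = ≡-to-≅ (identityʳ f)

  replace-middle : ∀ {V W X X′ Y Z} (f : Hom V W) {g : Hom W X} {h : Hom X Y}
                   {g′ : Hom W X′} {h′ : Hom X′ Y} (k : Hom Y Z) →
                   g ⨾ h ≡ g′ ⨾ h′ → (f ⨾ g) ⨾ (h ⨾ k) ≡ (f ⨾ g′) ⨾ (h′ ⨾ k)
  replace-middle f {g} {h} {g′} {h′} k p = begin
    (f ⨾ g) ⨾ (h ⨾ k)    ≡⟨ regroup g h ⟩
    f ⨾ (g ⨾ h) ⨾ k      ≡⟨ ≡.cong (λ x → f ⨾ x ⨾ k) p ⟩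
    f ⨾ (g′ ⨾ h′) ⨾ k    ≡⟨ regroup g′ h′ ⟨
    (f ⨾ g′) ⨾ (h′ ⨾ k)  ∎
    where
    open ≡.≡-Reasoning
    regroup : ∀ {X} (g : Hom _ X) (h : Hom X _) → (f ⨾ g) ⨾ (h ⨾ k) ≡ f ⨾ (g ⨾ h) ⨾ k
    regroup g h = ≡.trans (≡.sym (assoc (f ⨾ g) h k)) (≡.cong (_⨾ k) (assoc f g h))

-- In a premonoidal category the tensor of two morphisms has to choose an order of
-- execution; it is functorial where the order does not matter.
module SequentialTensor {𝐌 : ObjMonoid o} (𝐂 : StrictPremonoidal 𝐌 ℓ) where
  open ObjMonoid 𝐌
  open StrictPremonoidal 𝐂
  open CategoryProperties category
  private
    module ⋉ {A} = FunctorOver (leftWhisker A)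
    module ⋊ {A} = FunctorOver (rightWhisker A)

  infixr 7 _⊛_
  _⊛_ : ∀ {X Y X′ Y′} → Hom X Y → Hom X′ Y′ → Hom (X ⊗₀ X′) (Y ⊗₀ Y′)
  _⊛_ {Y = Y} {X′ = X′} f g = (f ⋊ X′) ⨾ (Y ⋉ g)

  -- One half of `Central` for a single pair: the first component of the centrality of `f` is
  -- `Commute f g`, the second one, reversed, is `Commute g f`.
  Commute : ∀ {A B C D} → Hom A B → Hom C D → Set ℓ
  Commute {A} {B} {C} {D} f g = (A ⋉ g) ⨾ (f ⋊ D) ≡ (f ⋊ C) ⨾ (B ⋉ g)

  ⊛-idʳ : ∀ {X Y} (f : Hom X Y) A → f ⊛ id→ {A} ≡ f ⋊ A
  ⊛-idʳ f A = ≡.trans (≡.cong ((f ⋊ A) ⨾_) ⋉.map-id) (identityʳ (f ⋊ A))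

  ⊛-idˡ : ∀ A {X Y} (f : Hom X Y) → id→ {A} ⊛ f ≡ A ⋉ f
  ⊛-idˡ A f = ≡.trans (≡.cong (_⨾ (A ⋉ f)) ⋊.map-id) (identityˡ (A ⋉ f))

  -- No commutation is required: both bracketings run `f`, then `g`, then `h`, and only the
  -- whiskerings have to be regrouped.
  ⊛-assoc : ∀ {X Y X′ Y′ X″ Y″} (f : Hom X Y) (g : Hom X′ Y′) (h : Hom X″ Y″) →
            (f ⊛ g) ⊛ h ≅ f ⊛ (g ⊛ h)
  ⊛-assoc {X} {Y} {X′} {Y′} {X″} {Y″} f g h = begin
    ((f ⋊ X′) ⨾ (Y ⋉ g)) ⋊ X″ ⨾ ((Y ⊗₀ Y′) ⋉ h)
      ≡⟨ ≡.cong (_⨾ ((Y ⊗₀ Y′) ⋉ h)) (⋊.map-⨾ (f ⋊ X′) (Y ⋉ g)) ⟩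
    ((f ⋊ X′) ⋊ X″) ⨾ ((Y ⋉ g) ⋊ X″) ⨾ ((Y ⊗₀ Y′) ⋉ h)
      ≅⟨ ⨾-≅ (⊗₀-assoc X X′ X″) (⊗₀-assoc Y Y′ X″) (⊗₀-assoc Y Y′ Y″)
           (⨾-≅ (⊗₀-assoc X X′ X″) (⊗₀-assoc Y X′ X″) (⊗₀-assoc Y Y′ X″)
             (≅.sym (⋊-⊗₀ X′ X″ f)) (⋉-⋊-assoc Y X″ g))
           (⋉-⊗₀ Y Y′ h) ⟩
    (f ⋊ (X′ ⊗₀ X″)) ⨾ (Y ⋉ (g ⋊ X″)) ⨾ (Y ⋉ (Y′ ⋉ h))
      ≡⟨ assoc _ _ _ ⟩
    (f ⋊ (X′ ⊗₀ X″)) ⨾ ((Y ⋉ (g ⋊ X″)) ⨾ (Y ⋉ (Y′ ⋉ h)))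
      ≡⟨ ≡.cong ((f ⋊ (X′ ⊗₀ X″)) ⨾_) (⋉.map-⨾ (g ⋊ X″) (Y′ ⋉ h)) ⟨
    f ⊛ (g ⊛ h) ∎
    where open ≅.≅-Reasoning

  -- The left side runs `f`, `g`, `h`, `k` and the right side `f`, `h`, `g`, `k`, so exchanging the
  -- middle pair is enough.
  ⊛-⨾ : ∀ {X Y Z X′ Y′ Z′} (f : Hom X Y) (g : Hom X′ Y′) (h : Hom Y Z) (k : Hom Y′ Z′) →
        Commute h g → (f ⊛ g) ⨾ (h ⊛ k) ≡ (f ⨾ h) ⊛ (g ⨾ k)
  ⊛-⨾ {Z = Z} {X′ = X′} f g h k comm = ≡.trans
    (replace-middle (f ⋊ X′) (Z ⋉ k) comm)
    (≡.sym (≡.cong₂ _⨾_ (⋊.map-⨾ f h) (⋉.map-⨾ g k)))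

  ⊛-identityˡ : ∀ {X Y} (f : Hom X Y) → id→ {I} ⊛ f ≅ f
  ⊛-identityˡ f = ≅.trans (≡-to-≅ (⊛-idˡ I f)) (⋉-identity f)

  ⊛-identityʳ : ∀ {X Y} (f : Hom X Y) → f ⊛ id→ {I} ≅ f
  ⊛-identityʳ f = ≅.trans (≡-to-≅ (⊛-idʳ f I)) (⋊-identity f)

  module _ (𝐒 : SymmetricPremonoidal 𝐂) where
    open SymmetricPremonoidal 𝐒

    -- Sliding the braiding to the front leaves `f` running before `g`, whereas `g ⊛ f` runs `g`
    -- first.
    ⊛-σ : ∀ {X Y X′ Y′} (f : Hom X Y) (g : Hom X′ Y′) → Commute g f →
          (f ⊛ g) ⨾ σ Y Y′ ≡ σ X X′ ⨾ (g ⊛ f)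
    ⊛-σ {X} {Y} {X′} {Y′} f g comm = begin
      (f ⋊ X′) ⨾ (Y ⋉ g) ⨾ σ Y Y′    ≡⟨ assoc _ _ _ ⟩
      (f ⋊ X′) ⨾ ((Y ⋉ g) ⨾ σ Y Y′)  ≡⟨ ≡.cong ((f ⋊ X′) ⨾_) (σ-naturalʳ g Y) ⟩
      (f ⋊ X′) ⨾ (σ Y X′ ⨾ (g ⋊ Y))  ≡⟨ assoc _ _ _ ⟨
      (f ⋊ X′) ⨾ σ Y X′ ⨾ (g ⋊ Y)    ≡⟨ ≡.cong (_⨾ (g ⋊ Y)) (σ-naturalˡ f X′) ⟩
      σ X X′ ⨾ (X′ ⋉ f) ⨾ (g ⋊ Y)    ≡⟨ assoc _ _ _ ⟩
      σ X X′ ⨾ ((X′ ⋉ f) ⨾ (g ⋊ Y))  ≡⟨ ≡.cong (σ X X′ ⨾_) comm ⟩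
      σ X X′ ⨾ (g ⊛ f)               ∎
      where open ≡.≡-Reasoning

-- From Freyd categories to graded categories

open PCM 𝟐 using (_⊕_↦_; _⩽_; 𝟘⩽)

one⋠zero : {A : Set ℓ} → one ⩽ zero → A
one⋠zero (zero , ())
one⋠zero (one , ())

module FreydToGraded (𝐀 : FreydCategory o ℓ) where
  open FreydCategory 𝐀
  open SequentialTensor ℂ
  open IsStrictPremonoidalFunctor η-premonoidal
  private
    module η = FunctorOver η

  category : Two → CategoryOn Obj ℓ
  category zero = V.category
  category one  = C.category

  Hom : Two → Obj → Obj → Set ℓ
  Hom a = CategoryOn.Hom (category a)

  regrading : ∀ {a b} → a ⩽ b → FunctorOver id (category a) (category b)
  regrading {zero} {zero} p = idFunctor
  regrading {zero} {one}  p = η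
  regrading {one}  {one}  p = idFunctor
  regrading {one}  {zero} p = one⋠zero p

  regrade : ∀ {a b} → a ⩽ b → ∀ {X Y} → Hom a X Y → Hom b X Y
  regrade p = FunctorOver.map (regrading p)

  -- Recursion on the grade, in place of `regrade`, avoids a witness of `a ⩽ one` and gives one
  -- formula for all tensors, `effect-tensor`. Since `η` need not be faithful, effects decide
  -- equations at grade one only; those at grade zero are separate cases.
  effect : ∀ a {X Y} → Hom a X Y → C.Hom X Y
  effect zero f = η.map f
  effect one  f = f

  tensor : ∀ {a b c} → a ⊕ b ↦ c → ∀ {X Y X′ Y′} →
           Hom a X Y → Hom b X′ Y′ → Hom c (X ⊗₀ X′) (Y ⊗₀ Y′)
  tensor {zero} {zero} refl f g = f V.⊗ g
  tensor {zero} {one}  refl f g = η.map f ⊛ g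
  tensor {one}  {zero} refl f g = f ⊛ η.map g
  tensor {one}  {one}  ()

  -- `η` is only known to preserve whiskerings, so `f ⊗ g` is first split into two whiskered
  -- factors, in the order in which `⊛` runs them.
  η-⊗ : ∀ {X Y X′ Y′} (f : V.Hom X Y) (g : V.Hom X′ Y′) → η.map (f V.⊗ g) ≡ η.map f ⊛ η.map g
  η-⊗ f g = begin
    η.map (f V.⊗ g)
      ≡⟨ ≡.cong η.map (≡.cong₂ V._⊗_ (V.identityʳ f) (V.identityˡ g)) ⟨
    η.map ((f V.⨾ V.id→) V.⊗ (V.id→ V.⨾ g))
      ≡⟨ ≡.cong η.map (V.⊗-⨾ f V.id→ V.id→ g) ⟨
    η.map ((f V.⊗ V.id→) V.⨾ (V.id→ V.⊗ g))
      ≡⟨ η.map-⨾ _ _ ⟩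
    η.map (f V.⊗ V.id→) C.⨾ η.map (V.id→ V.⊗ g)
      ≡⟨ ≡.cong₂ C._⨾_ (≅-to-≡ (⋊-homo f _)) (≅-to-≡ (⋉-homo _ g)) ⟩
    η.map f ⊛ η.map g ∎
    where open ≡.≡-Reasoning

  effect-regrade : ∀ {a b} (p : a ⩽ b) {X Y} (f : Hom a X Y) →
                   effect b (regrade p f) ≡ effect a f
  effect-regrade {zero} {zero} p f = refl
  effect-regrade {zero} {one}  p f = refl
  effect-regrade {one}  {one}  p f = refl
  effect-regrade {one}  {zero} p f = one⋠zero p

  effect-tensor : ∀ {a b c} (p : a ⊕ b ↦ c) {X Y X′ Y′} (f : Hom a X Y) (g : Hom b X′ Y′) →
                  effect c (tensor p f g) ≡ effect a f ⊛ effect b g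
  effect-tensor {zero} {zero} refl f g = η-⊗ f g
  effect-tensor {zero} {one}  refl f g = refl
  effect-tensor {one}  {zero} refl f g = refl
  effect-tensor {one}  {one}  ()

  commute : ∀ {a b c} → a ⊕ b ↦ c → ∀ {X Y X′ Y′} (f : Hom a X Y) (g : Hom b X′ Y′) →
            Commute (effect a f) (effect b g)
  commute {zero} {b}    p  f g = proj₁ (η-central f (effect b g))
  commute {one}  {zero} p  f g = ≡.sym (proj₂ (η-central g f))
  commute {one}  {one}  ()

  regrade-refl : ∀ {a} (p : a ⩽ a) {X Y} (f : Hom a X Y) → regrade p f ≡ f
  regrade-refl {zero} p f = refl
  regrade-refl {one}  p f = refl

  -- The function effect one is the identity, so an equation at grade one holds as soon as
  -- it holds between effects.
  regrade-trans : ∀ {a b c} (p : a ⩽ b) (q : b ⩽ c) (r : a ⩽ c) {X Y} (f : Hom a X Y) →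
                  regrade q (regrade p f) ≡ regrade r f
  regrade-trans {zero} {zero} {zero} p q r f = refl
  regrade-trans {zero} {one}  {zero} p q r f = one⋠zero q
  regrade-trans {one}  {c = zero}    p q r f = one⋠zero r
  regrade-trans {a}    {b}    {one}  p q r f = ≡.trans (effect-regrade q (regrade p f))
    (≡.trans (effect-regrade p f) (≡.sym (effect-regrade r f)))

  regrade-tensor : ∀ {a b c d m n} (p : a ⊕ b ↦ m) (q : c ⊕ d ↦ n)
                   (r : a ⩽ c) (s : b ⩽ d) (t : m ⩽ n)
                   {X Y X′ Y′} (f : Hom a X Y) (g : Hom b X′ Y′) →
                   regrade t (tensor p f g) ≡ tensor q (regrade r f) (regrade s g)
  -- A tensor of grade zero has both factors of grade zero, and grade one does not regrade to zero;
  -- so the other cases with `n = zero` are absurd.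
  regrade-tensor {zero} {zero} {zero} {zero} {n = zero} refl refl r s t f g = refl
  regrade-tensor {one}  {b}    {zero} {d}    {n = zero} p q r s t f g = one⋠zero r
  regrade-tensor {a}    {one}  {c}    {zero} {n = zero} p q r s t f g = one⋠zero s
  regrade-tensor {c = zero} {one}  {n = zero} p () r s t f g
  regrade-tensor {c = one}  {zero} {n = zero} p () r s t f g
  regrade-tensor {c = one}  {one}  {n = zero} p () r s t f g
  regrade-tensor {a} {b} {c} {d} {m} {one} p q r s t f g = begin
    regrade t (tensor p f g)                       ≡⟨ effect-regrade t (tensor p f g) ⟩
    effect m (tensor p f g)                        ≡⟨ effect-tensor p f g ⟩
    effect a f ⊛ effect b g
      ≡⟨ ≡.cong₂ _⊛_ (effect-regrade r f) (effect-regrade s g) ⟨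
    effect c (regrade r f) ⊛ effect d (regrade s g)
      ≡⟨ effect-tensor q (regrade r f) (regrade s g) ⟨
    tensor q (regrade r f) (regrade s g)           ∎
    where open ≡.≡-Reasoning

  tensor-identityˡ : ∀ {a X Y} (f : Hom a X Y) →
                     tensor {zero} {a} (PCM.identityˡ 𝟐 a) (V.id→ {I}) f ≅ f
  tensor-identityˡ {zero} f = V.⊗-identityˡ f
  tensor-identityˡ {one}  f = ≅.trans (≡-to-≅ (≡.cong (_⊛ f) η.map-id)) (⊛-identityˡ f)

  tensor-identityʳ : ∀ {a X Y} (f : Hom a X Y) →
                     tensor {a} {zero} (PCM.identityʳ 𝟐 a) f (V.id→ {I}) ≅ f
  tensor-identityʳ {zero} f = V.⊗-identityʳ f
  tensor-identityʳ {one}  f = ≅.trans (≡-to-≅ (≡.cong (f ⊛_) η.map-id)) (⊛-identityʳ f)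

  tensor-assoc : ∀ {a b c m n k} (p : a ⊕ b ↦ m) (q : m ⊕ c ↦ k)
                 (r : b ⊕ c ↦ n) (s : a ⊕ n ↦ k)
                 {X Y X′ Y′ X″ Y″} (f : Hom a X Y) (g : Hom b X′ Y′) (h : Hom c X″ Y″) →
                 tensor q (tensor p f g) h ≅ tensor s f (tensor r g h)
  tensor-assoc {zero} {zero} {zero} {k = zero} refl refl refl refl f g h = V.⊗-assoc f g h
  tensor-assoc {a} {b} {c} {m} {n} {one} p q r s f g h = begin
    tensor q (tensor p f g) h             ≡⟨ effect-tensor q (tensor p f g) h ⟩
    effect m (tensor p f g) ⊛ effect c h  ≡⟨ ≡.cong (_⊛ effect c h) (effect-tensor p f g) ⟩
    (effect a f ⊛ effect b g) ⊛ effect c h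
      ≅⟨ ⊛-assoc (effect a f) (effect b g) (effect c h) ⟩
    effect a f ⊛ (effect b g ⊛ effect c h)
      ≡⟨ ≡.cong (effect a f ⊛_) (effect-tensor r g h) ⟨
    effect a f ⊛ effect n (tensor r g h)  ≡⟨ effect-tensor s f (tensor r g h) ⟨
    tensor s f (tensor r g h)             ∎
    where open ≅.≅-Reasoning
  tensor-assoc {zero} {zero} {one} {k = zero} refl () r s f g h
  tensor-assoc {zero} {one}  {zero} {k = zero} refl () r s f g h
  tensor-assoc {zero} {one}  {one} {k = zero} refl () r s f g h
  tensor-assoc {one}  {zero} {zero} {k = zero} refl () r s f g h
  tensor-assoc {one}  {zero} {one} {k = zero} refl () r s f g h
  tensor-assoc {one}  {one}  {k = zero} () q r s f g h

  tensor-⨾ : ∀ {a b c} (p : a ⊕ b ↦ c) {X Y Z X′ Y′ Z′}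
             (f : Hom a X Y) (g : Hom b X′ Y′) (h : Hom a Y Z) (k : Hom b Y′ Z′) →
             CategoryOn._⨾_ (category c) (tensor p f g) (tensor p h k) ≡
             tensor p (CategoryOn._⨾_ (category a) f h) (CategoryOn._⨾_ (category b) g k)
  tensor-⨾ {zero} {zero} refl f g h k = V.⊗-⨾ f g h k
  tensor-⨾ {zero} {one}  refl f g h k =
    ≡.trans (⊛-⨾ _ _ _ _ (commute {zero} {one} refl h g)) (≡.cong (_⊛ _) (≡.sym (η.map-⨾ f h)))
  tensor-⨾ {one}  {zero} refl f g h k =
    ≡.trans (⊛-⨾ _ _ _ _ (commute {one} {zero} refl h g)) (≡.cong (_ ⊛_) (≡.sym (η.map-⨾ g k)))
  tensor-⨾ {one}  {one}  ()

  -- The axioms are proved by cases on the grades so that pureMonoidal graded computes to 𝕍: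
  -- hence the symmetric and the cartesian structure of 𝕍 can be reused, and survive both
  -- round trips unchanged.
  graded : GradedMonoidal 𝟐 o ℓ
  graded = record
    { objects          = objects
    ; category         = category
    ; regrading        = regrading
    ; tensor           = tensor
    ; regrade-refl     = regrade-refl
    ; regrade-trans    = regrade-trans
    ; regrade-tensor   = regrade-tensor
    ; tensor-identityˡ = λ {a} → tensor-identityˡ {a}
    ; tensor-identityʳ = λ {a} → tensor-identityʳ {a}
    ; tensor-assoc     = tensor-assoc
    ; tensor-id        = V.⊗-id
    ; tensor-⨾         = tensor-⨾
    }

  σ-natural : ∀ {a b c} (p : a ⊕ b ↦ c) (q : b ⊕ a ↦ c)
              {X Y X′ Y′} (f : Hom a X Y) (g : Hom b X′ Y′) →
              CategoryOn._⨾_ (category c) (tensor p f g)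
                (regrade {zero} {c} (𝟘⩽ c) (VS.σ Y Y′)) ≡
              CategoryOn._⨾_ (category c) (regrade {zero} {c} (𝟘⩽ c) (VS.σ X X′))
                (tensor q g f)
  σ-natural {zero} {zero} refl refl f g = VS.σ-natural f g
  σ-natural {a} {b} {one} p q {X} {Y} {X′} {Y′} f g = begin
    tensor p f g C.⨾ η.map (VS.σ Y Y′)
      ≡⟨ ≡.cong₂ C._⨾_ (effect-tensor p f g) (η-σ Y Y′) ⟩
    (effect a f ⊛ effect b g) C.⨾ CS.σ Y Y′
      ≡⟨ ⊛-σ ℂ-symmetric (effect a f) (effect b g) (commute q g f) ⟩
    CS.σ X X′ C.⨾ (effect b g ⊛ effect a f)
      ≡⟨ ≡.cong₂ C._⨾_ (η-σ X X′) (effect-tensor q g f) ⟨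
    η.map (VS.σ X X′) C.⨾ tensor q g f ∎
    where open ≡.≡-Reasoning
  σ-natural {zero} {one}  {zero} ()
  σ-natural {one}  {zero} {zero} ()
  σ-natural {one}  {one}  {zero} ()

  cartesianGraded : CartesianGraded 𝟐 o ℓ
  cartesianGraded = record
    { graded    = graded
    ; symmetric = record
      { pureSymmetric    = 𝕍-symmetric
      ; σ-natural-graded = σ-natural
      }
    ; cartesian = 𝕍-cartesian
    }

-- From graded categories to Freyd categories

module GradedToFreyd (𝐂 : CartesianGraded 𝟐 o ℓ) where
  open CartesianGraded 𝐂
  open SymmetricGraded symmetric using (pureSymmetric; σ-natural-graded; σ; σ-involutive; σ-⊗; σ-I)
  module Pure = StrictMonoidal pureMonoidal

  -- This is the witness that occurs in `σ-natural-graded`, so that instances of that axiom are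
  -- literally the naturality laws of `effectsSymmetric`.
  0⩽1 : zero ⩽ one
  0⩽1 = 𝟘⩽ one

  module η = FunctorOver (regrading {zero} {one} 0⩽1)
  open CategoryOn (category one) using () renaming
    (id→ to id₁; identityˡ to ⨾-identityˡ; identityʳ to ⨾-identityʳ; id[_] to id₁[_])

  infixr 7 _⋉_ _⊗₀₁_
  infixl 7 _⋊_ _⊗₁₀_

  _⊗₀₁_ : ∀ {X Y X′ Y′} → Hom zero X Y → Hom one X′ Y′ → Hom one (X ⊗₀ X′) (Y ⊗₀ Y′)
  _⊗₀₁_ = tensor {zero} {one} refl

  _⊗₁₀_ : ∀ {X Y X′ Y′} → Hom one X Y → Hom zero X′ Y′ → Hom one (X ⊗₀ X′) (Y ⊗₀ Y′)
  _⊗₁₀_ = tensor {one} {zero} refl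

  _⋉_ : ∀ A {X Y} → Hom one X Y → Hom one (A ⊗₀ X) (A ⊗₀ Y)
  A ⋉ f = id₀ {A} ⊗₀₁ f

  _⋊_ : ∀ {X Y} → Hom one X Y → ∀ A → Hom one (X ⊗₀ A) (Y ⊗₀ A)
  f ⋊ A = f ⊗₁₀ id₀ {A}

  -- As 1 = 0 ⊕ 1 = 1 ⊕ 0, raising a pure tensor to grade one can be charged to either factor, the
  -- other being regraded along 0 ⩽ 0, which changes nothing. That both choices give the same
  -- morphism is the source of centrality.
  η-⊗₀₁ : ∀ {X Y X′ Y′} (f : Hom zero X Y) (g : Hom zero X′ Y′) →
          η.map (f Pure.⊗ g) ≡ f ⊗₀₁ η.map g
  η-⊗₀₁ f g = ≡.trans (regrade-tensor refl refl (𝟘⩽ zero) 0⩽1 0⩽1 f g)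
    (≡.cong (_⊗₀₁ η.map g) (regrade-refl (𝟘⩽ zero) f))

  η-⊗₁₀ : ∀ {X Y X′ Y′} (f : Hom zero X Y) (g : Hom zero X′ Y′) →
          η.map (f Pure.⊗ g) ≡ η.map f ⊗₁₀ g
  η-⊗₁₀ f g = ≡.trans (regrade-tensor refl refl 0⩽1 (𝟘⩽ zero) 0⩽1 f g)
    (≡.cong (η.map f ⊗₁₀_) (regrade-refl (𝟘⩽ zero) g))

  -- `tensor-⨾` composes only tensors with the same pair of grades, while `_⋊_` has grades 1, 0 and
  -- `_⋉_` has grades 0, 1. Beside a pure morphism the effectful grade can be moved to the identity,
  -- after which interchange applies.
  η-⋊ : ∀ {X Y} (f : Hom zero X Y) A → η.map f ⋊ A ≡ f ⊗₀₁ id₁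
  η-⋊ f A = begin
    η.map f ⋊ A            ≡⟨ η-⊗₁₀ f id₀ ⟨
    η.map (f Pure.⊗ id₀)   ≡⟨ η-⊗₀₁ f id₀ ⟩
    f ⊗₀₁ η.map id₀        ≡⟨ ≡.cong (f ⊗₀₁_) η.map-id ⟩
    f ⊗₀₁ id₁              ∎
    where open ≡.≡-Reasoning

  ⋉-η : ∀ A {X Y} (f : Hom zero X Y) → A ⋉ η.map f ≡ id₁ ⊗₁₀ f
  ⋉-η A f = begin
    A ⋉ η.map f            ≡⟨ η-⊗₀₁ id₀ f ⟨
    η.map (id₀ Pure.⊗ f)   ≡⟨ η-⊗₁₀ id₀ f ⟩
    η.map id₀ ⊗₁₀ f        ≡⟨ ≡.cong (_⊗₁₀ f) η.map-id ⟩
    id₁ ⊗₁₀ f              ∎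
    where open ≡.≡-Reasoning

  -- Both orders of execution collapse to the same graded tensor, whence `η-central`. The order here
  -- is that of `⊛`, so this lemma and `⋊-⨾-⋉η` also recover `tensor` after the round trip.
  η⋊-⨾-⋉ : ∀ {X Y X′ Y′} (f : Hom zero X Y) (g : Hom one X′ Y′) →
          (η.map f ⋊ X′) ⨾ (Y ⋉ g) ≡ f ⊗₀₁ g
  η⋊-⨾-⋉ {X′ = X′} {Y′} f g = begin
    (η.map f ⋊ X′) ⨾ (id₀ ⊗₀₁ g)   ≡⟨ ≡.cong (_⨾ (id₀ ⊗₀₁ g)) (η-⋊ f X′) ⟩
    (f ⊗₀₁ id₁) ⨾ (id₀ ⊗₀₁ g)      ≡⟨ tensor-⨾ refl f id₁ id₀ g ⟩
    (f ⨾ id₀) ⊗₀₁ (id₁ ⨾ g)        ≡⟨ ≡.cong₂ _⊗₀₁_ (Pure.identityʳ f) (⨾-identityˡ g) ⟩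
    f ⊗₀₁ g                        ∎
    where open ≡.≡-Reasoning

  ⋉-⨾-η⋊ : ∀ {X Y X′ Y′} (f : Hom zero X Y) (g : Hom one X′ Y′) →
          (X ⋉ g) ⨾ (η.map f ⋊ Y′) ≡ f ⊗₀₁ g
  ⋉-⨾-η⋊ {X′ = X′} {Y′} f g = begin
    (id₀ ⊗₀₁ g) ⨾ (η.map f ⋊ Y′)   ≡⟨ ≡.cong ((id₀ ⊗₀₁ g) ⨾_) (η-⋊ f Y′) ⟩
    (id₀ ⊗₀₁ g) ⨾ (f ⊗₀₁ id₁)      ≡⟨ tensor-⨾ refl id₀ g f id₁ ⟩
    (id₀ ⨾ f) ⊗₀₁ (g ⨾ id₁)        ≡⟨ ≡.cong₂ _⊗₀₁_ (Pure.identityˡ f) (⨾-identityʳ g) ⟩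
    f ⊗₀₁ g                        ∎
    where open ≡.≡-Reasoning

  ⋊-⨾-⋉η : ∀ {X Y X′ Y′} (g : Hom one X Y) (f : Hom zero X′ Y′) →
          (g ⋊ X′) ⨾ (Y ⋉ η.map f) ≡ g ⊗₁₀ f
  ⋊-⨾-⋉η {X} {Y} {X′} g f = begin
    (g ⊗₁₀ id₀) ⨾ (Y ⋉ η.map f)    ≡⟨ ≡.cong ((g ⊗₁₀ id₀) ⨾_) (⋉-η Y f) ⟩
    (g ⊗₁₀ id₀) ⨾ (id₁ ⊗₁₀ f)      ≡⟨ tensor-⨾ refl g id₀ id₁ f ⟩
    (g ⨾ id₁) ⊗₁₀ (id₀ ⨾ f)        ≡⟨ ≡.cong₂ _⊗₁₀_ (⨾-identityʳ g) (Pure.identityˡ f) ⟩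
    g ⊗₁₀ f                        ∎
    where open ≡.≡-Reasoning

  ⋉η-⨾-⋊ : ∀ {X Y X′ Y′} (g : Hom one X Y) (f : Hom zero X′ Y′) →
          (X ⋉ η.map f) ⨾ (g ⋊ Y′) ≡ g ⊗₁₀ f
  ⋉η-⨾-⋊ {X} {Y} {X′} g f = begin
    (X ⋉ η.map f) ⨾ (g ⊗₁₀ id₀)    ≡⟨ ≡.cong (_⨾ (g ⊗₁₀ id₀)) (⋉-η X f) ⟩
    (id₁ ⊗₁₀ f) ⨾ (g ⊗₁₀ id₀)      ≡⟨ tensor-⨾ refl id₁ f g id₀ ⟩
    (id₁ ⨾ g) ⊗₁₀ (f ⨾ id₀)        ≡⟨ ≡.cong₂ _⊗₁₀_ (⨾-identityˡ g) (Pure.identityʳ f) ⟩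
    g ⊗₁₀ f                        ∎
    where open ≡.≡-Reasoning

  effects : StrictPremonoidal objects ℓ
  effects = record
    { category     = category one
    ; leftWhisker  = λ A → record
      { map    = A ⋉_
      -- `tensor-id` speaks of grade zero only, so `id₁` is replaced by `η.map id₀` and the law is
      -- taken from there.
      ; map-id = ≡.trans (≡.cong (A ⋉_) (≡.sym η.map-id))
          (≡.trans (≡.sym (η-⊗₀₁ id₀ id₀)) (≡.trans (≡.cong η.map tensor-id) η.map-id))
      ; map-⨾  = λ f g → ≡.trans (≡.cong (_⊗₀₁ (f ⨾ g)) (≡.sym (Pure.identityˡ id₀)))
          (≡.sym (tensor-⨾ refl id₀ f id₀ g))
      }
    ; rightWhisker = λ A → record
      { map    = _⋊ A
      ; map-id = ≡.trans (≡.cong (_⋊ A) (≡.sym η.map-id))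
          (≡.trans (≡.sym (η-⊗₁₀ id₀ id₀)) (≡.trans (≡.cong η.map tensor-id) η.map-id))
      ; map-⨾  = λ f g → ≡.trans (≡.cong ((f ⨾ g) ⊗₁₀_) (≡.sym (Pure.identityˡ id₀)))
          (≡.sym (tensor-⨾ refl f id₀ g id₀))
      }
    ; ⋉-⋊-assoc    = λ A B f → tensor-assoc refl refl refl refl id₀ f id₀
    ; ⋉-⊗₀         = λ A B f → ≅.trans (≡-to-≅ (≡.cong (_⊗₀₁ f) (≡.sym tensor-id)))
        (tensor-assoc refl refl refl refl id₀ id₀ f)
    ; ⋊-⊗₀         = λ A B f → ≅.trans (≡-to-≅ (≡.cong (f ⊗₁₀_) (≡.sym tensor-id)))
        (≅.sym (tensor-assoc refl refl refl refl f id₀ id₀))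
    ; ⋉-identity   = tensor-identityˡ
    ; ⋊-identity   = tensor-identityʳ
    }

  open StrictPremonoidal effects using (Central)

  η-central : ∀ {X Y} (f : Hom zero X Y) → Central (η.map f)
  η-central f g = ≡.trans (⋉-⨾-η⋊ f g) (≡.sym (η⋊-⨾-⋉ f g))
                , ≡.trans (⋊-⨾-⋉η g f) (≡.sym (⋉η-⨾-⋊ g f))

  effectsSymmetric : SymmetricPremonoidal effects
  effectsSymmetric = record
    { σ            = λ X Y → η.map (σ X Y)
    ; σ-central    = λ X Y → η-central (σ X Y)
    ; σ-naturalˡ   = λ f Z → σ-natural-graded refl refl f id₀
    ; σ-naturalʳ   = λ f Z → σ-natural-graded refl refl id₀ f
    ; σ-involutive = λ X Y → ≡.trans (≡.sym (η.map-⨾ (σ X Y) (σ Y X)))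
        (≡.trans (≡.cong η.map (σ-involutive X Y)) η.map-id)
    ; σ-⊗          = hexagon
    ; σ-I          = λ X → ≅.trans
        (map-≅ (regrading 0⩽1) (⊗₀-identityʳ X) (⊗₀-identityˡ X) (σ-I X))
        (≡-to-≅ η.map-id)
    }
    where
    -- This is the image under `η` of the pure hexagon: each whiskered braiding is a regraded pure
    -- tensor, and `η` sends coercions to coercions.
    hexagon : ∀ X Y Z → (η.map (σ X Y) ⋊ Z) ⨾ id₁[ ⊗₀-assoc Y X Z ] ⨾ (Y ⋉ η.map (σ X Z)) ≅
              η.map (σ X (Y ⊗₀ Z))
    hexagon X Y Z = begin
      (η.map (σ X Y) ⋊ Z) ⨾ id₁[ ⊗₀-assoc Y X Z ] ⨾ (Y ⋉ η.map (σ X Z))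
        ≡⟨ ≡.cong₂ _⨾_ (≡.cong₂ _⨾_ (η-⊗₁₀ (σ X Y) id₀) (η-id[] (⊗₀-assoc Y X Z)))
             (η-⊗₀₁ id₀ (σ X Z)) ⟨
      η.map (σ X Y Pure.⊗ id₀) ⨾ η.map Pure.id[ ⊗₀-assoc Y X Z ] ⨾ η.map (id₀ Pure.⊗ σ X Z)
        ≡⟨ ≡.cong (_⨾ η.map (id₀ Pure.⊗ σ X Z)) (η.map-⨾ _ _) ⟨
      η.map (σ X Y Pure.⊗ id₀ ⨾ Pure.id[ ⊗₀-assoc Y X Z ]) ⨾ η.map (id₀ Pure.⊗ σ X Z)
        ≡⟨ η.map-⨾ _ _ ⟨
      η.map (σ X Y Pure.⊗ id₀ ⨾ Pure.id[ ⊗₀-assoc Y X Z ] ⨾ id₀ Pure.⊗ σ X Z)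
        ≅⟨ map-≅ (regrading 0⩽1) (⊗₀-assoc X Y Z) (≡.sym (⊗₀-assoc Y Z X)) (σ-⊗ X Y Z) ⟩
      η.map (σ X (Y ⊗₀ Z)) ∎
      where
      open ≅.≅-Reasoning
      η-id[] : ∀ {X Y} (p : X ≡ Y) → η.map Pure.id[ p ] ≡ id₁[ p ]
      η-id[] refl = η.map-id

  freydCategory : FreydCategory o ℓ
  freydCategory = record
    { effectful   = record
      { objects       = objects
      ; 𝕍             = pureMonoidal
      ; 𝕍-symmetric   = pureSymmetric
      ; ℂ             = effects
      ; ℂ-symmetric   = effectsSymmetric
      ; η             = regrading 0⩽1
      ; η-premonoidal = record
        { ⋉-homo = λ A f → ≡-to-≅ (η-⊗₀₁ id₀ f)
        ; ⋊-homo = λ f A → ≡-to-≅ (η-⊗₁₀ f id₀)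
        }
      ; η-σ           = λ _ _ → refl
      ; η-central     = η-central
      }
    ; 𝕍-cartesian = cartesian
    }

-- Preservation of braidings and the action on morphisms

module _ {𝐌 : ObjMonoid o} {𝐍 : ObjMonoid o′}
         {𝐕 : StrictMonoidal 𝐌 ℓ} {𝐖 : StrictMonoidal 𝐍 ℓ′}
         {𝐕-symmetric : Symmetric 𝐕} {𝐖-symmetric : Symmetric 𝐖}
         (𝐕-cartesian : Cartesian 𝐕-symmetric) (𝐖-cartesian : Cartesian 𝐖-symmetric)
         {h : MonoidHom 𝐌 𝐍} where
  private
    module M = ObjMonoid 𝐌
    module N = ObjMonoid 𝐍
    module V where
      open StrictMonoidal 𝐕 public
      open Symmetric 𝐕-symmetric public
      open Cartesian 𝐕-cartesian public
      open CategoryProperties category public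
    module W where
      open StrictMonoidal 𝐖 public
      open Symmetric 𝐖-symmetric public
      open Cartesian 𝐖-cartesian public
      open CategoryProperties category public
    open MonoidHomomorphism h using (⟦_⟧; homo; ε-homo)

    ⊗-≅ : ∀ {X X̂ Y Ŷ X′ X̂′ Y′ Ŷ′}
          {f : W.Hom X Y} {f̂ : W.Hom X̂ Ŷ} {g : W.Hom X′ Y′} {ĝ : W.Hom X̂′ Ŷ′} →
          X ≡ X̂ → Y ≡ Ŷ → X′ ≡ X̂′ → Y′ ≡ Ŷ′ → f ≅ f̂ → g ≅ ĝ → f W.⊗ g ≅ f̂ W.⊗ ĝ
    ⊗-≅ refl refl refl refl refl refl = refl

    -- A functor reaches the product `A ⊗₀ B` only up to an equation between objects, so the source,
    -- the target and the projections for `k` are variables. Once they are matched, `k` and the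
    -- braiding are the same pairing.
    σ-unique : ∀ {A B P Q} {k : W.Hom P Q} {p₁ : W.Hom Q B} {p₂ : W.Hom Q A} →
               P ≡ A N.⊗₀ B → Q ≡ B N.⊗₀ A → p₁ ≅ W.π₁ {B} {A} → p₂ ≅ W.π₂ {B} {A} →
               k W.⨾ p₁ ≅ W.π₂ {A} {B} → k W.⨾ p₂ ≅ W.π₁ {A} {B} → k ≅ W.σ A B
    σ-unique {A} {B} {k = k} refl refl refl refl q₁ q₂ = ≡-to-≅ (≡.trans
      (W.unique W.π₂ W.π₁ k (≅-to-≡ q₁) (≅-to-≡ q₂))
      (≡.sym (W.unique W.π₂ W.π₁ (W.σ A B) (W.σ-π₁ A B) (W.σ-π₂ A B))))

  -- The braiding is determined by the projections, and these are preserved because they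
  -- are built from the tensor and from maps to the terminal object I.
  strictMonoidal⇒σ-homo : {F : FunctorOver ⟦_⟧ V.category W.category} →
                          IsStrictMonoidalFunctor 𝐕 𝐖 h F →
                          ∀ X Y → FunctorOver.map F (V.σ X Y) ≅ W.σ ⟦ X ⟧ ⟦ Y ⟧
  strictMonoidal⇒σ-homo {F} strict X Y = σ-unique (homo X Y) (homo Y X) (map-π₁ Y X) (map-π₂ Y X)
    (≅.trans (≡-to-≅ (≡.trans (≡.sym (map-⨾ _ _)) (≡.cong map (V.σ-π₁ X Y)))) (map-π₂ X Y))
    (≅.trans (≡-to-≅ (≡.trans (≡.sym (map-⨾ _ _)) (≡.cong map (V.σ-π₂ X Y)))) (map-π₁ X Y))
    where
    open FunctorOver F
    open IsStrictMonoidalFunctor strict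
    open ≅.≅-Reasoning

    !-unique-≅ : ∀ {A J} (f : W.Hom A J) → J ≡ N.I → f ≅ W.![ A ]
    !-unique-≅ f refl = ≡-to-≅ (W.!-unique f)

    map-π₁ : ∀ A B → map (V.π₁ {A} {B}) ≅ W.π₁ {⟦ A ⟧} {⟦ B ⟧}
    map-π₁ A B = begin
      map (V.id→ V.⊗ V.![ B ] V.⨾ V.id[ M.⊗₀-identityʳ A ])
        ≅⟨ map-≅ F refl (≡.sym (M.⊗₀-identityʳ A)) (V.⨾-id[] _ (M.⊗₀-identityʳ A)) ⟩
      map (V.id→ V.⊗ V.![ B ])         ≅⟨ ⊗-homo V.id→ V.![ B ] ⟩
      map V.id→ W.⊗ map V.![ B ]
        ≅⟨ ⊗-≅ refl refl refl ε-homo (≡-to-≅ map-id) (!-unique-≅ _ ε-homo) ⟩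
      W.id→ W.⊗ W.![ ⟦ B ⟧ ]           ≅⟨ W.⨾-id[] _ (N.⊗₀-identityʳ ⟦ A ⟧) ⟨
      W.π₁                             ∎

    map-π₂ : ∀ A B → map (V.π₂ {A} {B}) ≅ W.π₂ {⟦ A ⟧} {⟦ B ⟧}
    map-π₂ A B = begin
      map (V.![ A ] V.⊗ V.id→ V.⨾ V.id[ M.⊗₀-identityˡ B ])
        ≅⟨ map-≅ F refl (≡.sym (M.⊗₀-identityˡ B)) (V.⨾-id[] _ (M.⊗₀-identityˡ B)) ⟩
      map (V.![ A ] V.⊗ V.id→)         ≅⟨ ⊗-homo V.![ A ] V.id→ ⟩
      map V.![ A ] W.⊗ map V.id→
        ≅⟨ ⊗-≅ refl ε-homo refl refl (!-unique-≅ _ ε-homo) (≡-to-≅ map-id) ⟩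
      W.![ ⟦ A ⟧ ] W.⊗ W.id→           ≅⟨ W.⨾-id[] _ (N.⊗₀-identityˡ ⟦ B ⟧) ⟨
      W.π₂                             ∎

module _ {𝐀 𝐁 : FreydCategory o ℓ} (F : FreydFunctor 𝐀 𝐁) where
  private
    module A = FreydToGraded 𝐀
    module B = FreydToGraded 𝐁
    module 𝐀 = FreydCategory 𝐀
    module 𝐁 = FreydCategory 𝐁
    module ⊛A = SequentialTensor 𝐀.ℂ
    module ⊛B = SequentialTensor 𝐁.ℂ
    open FreydFunctor F
    open MonoidHomomorphism onObjects using (homo)
    open IsStrictMonoidalFunctor F₀-cartesian
    open IsStrictPremonoidalFunctor F₁-premonoidal
    open CategoryProperties 𝐁.C.category

    ⊛-homo : ∀ {X Y X′ Y′} (f : 𝐀.C.Hom X Y) (g : 𝐀.C.Hom X′ Y′) →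
             F₁.map (f ⊛A.⊛ g) ≅ F₁.map f ⊛B.⊛ F₁.map g
    ⊛-homo {X} {Y} {X′} {Y′} f g = ≅.trans (≡-to-≅ (F₁.map-⨾ _ _))
      (⨾-≅ (homo X X′) (homo Y X′) (homo Y Y′) (⋊-homo f X′) (⋉-homo Y g))

    functor : ∀ a → FunctorOver ⟦_⟧ (A.category a) (B.category a)
    functor zero = F₀
    functor one  = F₁

    tensor-homo : ∀ {a b c} (p : a ⊕ b ↦ c) {X Y X′ Y′} (g : A.Hom a X Y) (h : A.Hom b X′ Y′) →
                  FunctorOver.map (functor c) (A.tensor p g h) ≅
                  B.tensor p (FunctorOver.map (functor a) g) (FunctorOver.map (functor b) h)
    tensor-homo {zero} {zero} refl g h = ⊗-homo g h
    tensor-homo {zero} {one}  refl g h =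
      ≅.trans (⊛-homo _ h) (≡-to-≅ (≡.cong (⊛B._⊛ F₁.map h) (F₁-η g)))
    tensor-homo {one}  {zero} refl g h =
      ≅.trans (⊛-homo g _) (≡-to-≅ (≡.cong (F₁.map g ⊛B.⊛_) (F₁-η h)))
    tensor-homo {one}  {one}  ()

    regrade-homo : ∀ {a b} (p : a ⩽ b) {X Y} (g : A.Hom a X Y) →
                   FunctorOver.map (functor b) (A.regrade p g) ≡
                   B.regrade p (FunctorOver.map (functor a) g)
    regrade-homo {zero} {zero} p g = refl
    regrade-homo {zero} {one}  p g = F₁-η g
    regrade-homo {one}  {one}  p g = refl
    regrade-homo {one}  {zero} p g = one⋠zero p

  freydToGradedFunctor : GradedFunctor A.cartesianGraded B.cartesianGraded
  freydToGradedFunctor = record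
    { onObjects      = onObjects
    ; functor        = functor
    ; tensor-homo    = tensor-homo
    ; regrade-homo   = regrade-homo
    ; pure-cartesian = record { ⊗-homo = ⊗-homo }
    }

module _ {𝐂 𝐃 : CartesianGraded 𝟐 o ℓ} (F : GradedFunctor 𝐂 𝐃) where
  private
    module C = CartesianGraded 𝐂
    module D = CartesianGraded 𝐃
    module C↦ = GradedToFreyd 𝐂
    module D↦ = GradedToFreyd 𝐃
    open GradedFunctor F
    open MonoidHomomorphism onObjects using (homo)
    module F₀ = FunctorOver (functor zero)

    σ-homo : ∀ X Y → map (SymmetricGraded.σ C.symmetric X Y) ≅
                     SymmetricGraded.σ D.symmetric ⟦ X ⟧ ⟦ Y ⟧
    σ-homo = strictMonoidal⇒σ-homo C.cartesian D.cartesian pure-cartesian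

  gradedToFreydFunctor : FreydFunctor C↦.freydCategory D↦.freydCategory
  gradedToFreydFunctor = record
    { onObjects      = onObjects
    ; F₀             = functor zero
    ; F₁             = functor one
    ; F₀-cartesian   = pure-cartesian
    ; F₀-σ           = σ-homo
    ; F₁-premonoidal = record
      { ⋉-homo = λ A f → ≅.trans (tensor-homo refl C.id₀ f)
          (≡-to-≅ (≡.cong (λ i → i D↦.⊗₀₁ map f) F₀.map-id))
      ; ⋊-homo = λ f A → ≅.trans (tensor-homo refl f C.id₀)
          (≡-to-≅ (≡.cong (map f D↦.⊗₁₀_) F₀.map-id))
      }
    ; F₁-σ           = λ X Y → ≅.trans
        (≡-to-≅ (regrade-homo C↦.0⩽1 (SymmetricGraded.σ C.symmetric X Y)))
        (map-≅ (D.regrading D↦.0⩽1) (homo X Y) (homo Y X) (σ-homo X Y))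
    ; F₁-η           = regrade-homo C↦.0⩽1
    }

to : Functor (Freyd o ℓ) (Cart 𝟐 -GradMon o ℓ)
to = record
  { obj      = FreydToGraded.cartesianGraded
  ; map      = freydToGradedFunctor
  ; map-cong = λ p → record
    { ≈-objects = _≈Freyd_.≈-objects p
    ; ≈-map     = λ { {zero} → _≈Freyd_.≈-F₀ p ; {one} → _≈Freyd_.≈-F₁ p }
    }
  ; map-id   = record
    { ≈-objects = λ _ → refl ; ≈-map = λ { {zero} _ → refl ; {one} _ → refl } }
  ; map-⨾    = λ _ _ → record
    { ≈-objects = λ _ → refl ; ≈-map = λ { {zero} _ → refl ; {one} _ → refl } }
  }

from : Functor (Cart 𝟐 -GradMon o ℓ) (Freyd o ℓ)
from = record
  { obj      = GradedToFreyd.freydCategory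
  ; map      = gradedToFreydFunctor
  ; map-cong = λ p → record
    { ≈-objects = _≈Graded_.≈-objects p
    ; ≈-F₀      = _≈Graded_.≈-map p
    ; ≈-F₁      = _≈Graded_.≈-map p
    }
  ; map-id   = record
    { ≈-objects = λ _ → refl ; ≈-F₀ = λ _ → refl ; ≈-F₁ = λ _ → refl }
  ; map-⨾    = λ _ _ → record
    { ≈-objects = λ _ → refl ; ≈-F₀ = λ _ → refl ; ≈-F₁ = λ _ → refl }
  }

-- Equality of structures and the round trips

freydCategory-≡ : {𝐀 𝐁 : FreydCategory o ℓ} →
  FreydCategory.effectful 𝐀 ≡ FreydCategory.effectful 𝐁 →
  FreydCategory.𝕍-cartesian 𝐀 ≅ FreydCategory.𝕍-cartesian 𝐁 → 𝐀 ≡ 𝐁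
freydCategory-≡ refl refl = refl

-- The equations `p` and `q` come from extensionality and do not reduce, so the transport is removed
-- by matching on them as variables. Until then `F` and `F′` have unrelated domains, hence the
-- heterogeneously equal arguments. In the round trip the underlying objects and morphisms coincide
-- definitionally, and `refl` suffices.
subst₂-≈Freyd : {𝐀 𝐀′ 𝐁 𝐁′ : FreydCategory o ℓ} (p : 𝐀′ ≡ 𝐀) (q : 𝐁′ ≡ 𝐁)
  {F : FreydFunctor 𝐀 𝐁} {F′ : FreydFunctor 𝐀′ 𝐁′} →
  (∀ {X X′} → X′ ≅ X → FreydFunctor.⟦_⟧ F′ X′ ≅ FreydFunctor.⟦_⟧ F X) →
  (∀ {X X′ Y Y′} {f : FreydCategory.V.Hom 𝐀 X Y} {f′ : FreydCategory.V.Hom 𝐀′ X′ Y′} →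
     X′ ≅ X → Y′ ≅ Y → f′ ≅ f →
     FreydFunctor.F₀.map F′ f′ ≅ FreydFunctor.F₀.map F f) →
  (∀ {X X′ Y Y′} {f : FreydCategory.C.Hom 𝐀 X Y} {f′ : FreydCategory.C.Hom 𝐀′ X′ Y′} →
     X′ ≅ X → Y′ ≅ Y → f′ ≅ f →
     FreydFunctor.F₁.map F′ f′ ≅ FreydFunctor.F₁.map F f) →
  ≡.subst₂ FreydFunctor p q F′ ≈Freyd F
subst₂-≈Freyd refl refl objects pure effectful = record
  { ≈-objects = λ X → ≅-to-≡ (objects refl)
  ; ≈-F₀      = λ f → pure refl refl refl
  ; ≈-F₁      = λ f → effectful refl refl refl
  }

subst₂-≈Graded : {𝐂 𝐂′ 𝐃 𝐃′ : CartesianGraded 𝟐 o ℓ} (p : 𝐂′ ≡ 𝐂) (q : 𝐃′ ≡ 𝐃)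
  {F : GradedFunctor 𝐂 𝐃} {F′ : GradedFunctor 𝐂′ 𝐃′} →
  (∀ {X X′} → X′ ≅ X → GradedFunctor.⟦_⟧ F′ X′ ≅ GradedFunctor.⟦_⟧ F X) →
  (∀ a {X X′ Y Y′} {f : CartesianGraded.Hom 𝐂 a X Y} {f′ : CartesianGraded.Hom 𝐂′ a X′ Y′} →
     X′ ≅ X → Y′ ≅ Y → f′ ≅ f →
     GradedFunctor.map F′ f′ ≅ GradedFunctor.map F f) →
  ≡.subst₂ GradedFunctor p q F′ ≈Graded F
subst₂-≈Graded refl refl objects map = record
  { ≈-objects = λ X → ≅-to-≡ (objects refl)
  ; ≈-map     = λ {a} f → map a refl refl refl
  }

module _ {o ℓ} (ext : Extensionality (suc (o ⊔ ℓ)) (suc (o ⊔ ℓ))) where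
  private
    L = suc (o ⊔ ℓ)

  -- Extensionality at lower levels is recovered through the join with L, which equals L as
  -- soon as the levels a and b are known; the wrapper lets instance search perform this check.
  record Extensional a b : Set (suc (a ⊔ b)) where
    field
      extensionality : Extensionality a b
  open Extensional

  instance
    extensional : Extensional L L
    extensional .extensionality = ext

  funext : ∀ {a b} ⦃ e : Extensional (a ⊔ L) (b ⊔ L) ⦄ → Extensionality a b
  funext ⦃ e ⦄ = lower-extensionality L L (extensionality e)

  funextⁱ : ∀ {a b} ⦃ e : Extensional (a ⊔ L) (b ⊔ L) ⦄ → ExtensionalityImplicit a b
  funextⁱ = implicit-extensionality funext

  -- The axioms of the structures compared below are equations under quantifiers, so instance
  -- search finds that they are proof-irrelevant.
  record Law {a} (A : Set a) : Set a where
    field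
      unique : Irrelevant A
  open Law

  irrelevant : ∀ {a} {A : Set a} ⦃ l : Law A ⦄ → Irrelevant A
  irrelevant ⦃ l ⦄ = unique l

  instance
    ≡-law : ∀ {a} {A : Set a} {x y : A} → Law (x ≡ y)
    ≡-law .unique refl refl = refl

    ≅-law : ∀ {a} {A B : Set a} {x : A} {y : B} → Law (x ≅ y)
    ≅-law .unique refl refl = refl

    ×-law : ∀ {a b} {A : Set a} {B : Set b} ⦃ l : Law A ⦄ ⦃ m : Law B ⦄ → Law (A × B)
    ×-law .unique (x , y) (x′ , y′) = ≡.cong₂ _,_ (irrelevant x x′) (irrelevant y y′)

    ∀-law : ∀ {a b} {A : Set a} {B : A → Set b} ⦃ e : Extensional (a ⊔ L) (b ⊔ L) ⦄
            ⦃ l : ∀ {x} → Law (B x) ⦄ → Law (∀ x → B x)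
    ∀-law .unique f g = funext λ x → irrelevant (f x) (g x)

    ∀ⁱ-law : ∀ {a b} {A : Set a} {B : A → Set b} ⦃ e : Extensional (a ⊔ L) (b ⊔ L) ⦄
             ⦃ l : ∀ {x} → Law (B x) ⦄ → Law (∀ {x} → B x)
    ∀ⁱ-law .unique f g = funextⁱ λ {x} → irrelevant (f {x}) (g {x})

  strictPremonoidal-≡ : {𝐌 : ObjMonoid o} {𝐂 𝐃 : StrictPremonoidal 𝐌 ℓ} →
    StrictPremonoidal.category 𝐂 ≡ StrictPremonoidal.category 𝐃 →
    StrictPremonoidal.leftWhisker 𝐂 ≅ StrictPremonoidal.leftWhisker 𝐃 →
    StrictPremonoidal.rightWhisker 𝐂 ≅ StrictPremonoidal.rightWhisker 𝐃 →
    𝐂 ≡ 𝐃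
  strictPremonoidal-≡
    {𝐂 = record { ⋉-⋊-assoc = a ; ⋉-⊗₀ = b ; ⋊-⊗₀ = c ; ⋉-identity = d ; ⋊-identity = e }}
    {record { ⋉-⋊-assoc = a′ ; ⋉-⊗₀ = b′ ; ⋊-⊗₀ = c′ ; ⋉-identity = d′ ; ⋊-identity = e′ }}
    refl refl refl
    with irrelevant a a′ | irrelevant b b′ | irrelevant c c′
       -- Eta-expansion keeps the implicit quantifiers inside the law; otherwise they would be
       -- instantiated before the comparison.
       | irrelevant (λ {X Y} → d {X} {Y}) (λ {X Y} → d′ {X} {Y})
       | irrelevant (λ {X Y} → e {X} {Y}) (λ {X Y} → e′ {X} {Y})
  ... | refl | refl | refl | refl | refl = refl

  -- The pure structure is compared whole because it returns unchanged. The braiding of `ℂ` returns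
  -- as the image of the pure one, so `σ` is compared by itself and its laws agree by proof
  -- irrelevance.
  symmetricEffectful-≡ : {𝐀 𝐁 : SymmetricEffectful o ℓ} →
    SymmetricEffectful.objects 𝐀 ≡ SymmetricEffectful.objects 𝐁 →
    SymmetricEffectful.𝕍 𝐀 ≅ SymmetricEffectful.𝕍 𝐁 →
    SymmetricEffectful.𝕍-symmetric 𝐀 ≅ SymmetricEffectful.𝕍-symmetric 𝐁 →
    SymmetricEffectful.ℂ 𝐀 ≅ SymmetricEffectful.ℂ 𝐁 →
    SymmetricEffectful.CS.σ 𝐀 ≅ SymmetricEffectful.CS.σ 𝐁 →
    SymmetricEffectful.η 𝐀 ≅ SymmetricEffectful.η 𝐁 →
    𝐀 ≡ 𝐁
  symmetricEffectful-≡
    {record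
      { ℂ-symmetric = record
        { σ-central = a ; σ-naturalˡ = b ; σ-naturalʳ = c ; σ-involutive = d
        ; σ-⊗ = e ; σ-I = f }
      ; η-premonoidal = record { ⋉-homo = g ; ⋊-homo = h }
      ; η-σ = i ; η-central = j }}
    {record
      { ℂ-symmetric = record
        { σ-central = a′ ; σ-naturalˡ = b′ ; σ-naturalʳ = c′ ; σ-involutive = d′
        ; σ-⊗ = e′ ; σ-I = f′ }
      ; η-premonoidal = record { ⋉-homo = g′ ; ⋊-homo = h′ }
      ; η-σ = i′ ; η-central = j′ }}
    refl refl refl refl refl refl
    with irrelevant (λ X Y {C D} → a X Y {C} {D}) (λ X Y {C D} → a′ X Y {C} {D})
       | irrelevant (λ {X Y} → b {X} {Y}) (λ {X Y} → b′ {X} {Y})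
       | irrelevant (λ {X Y} → c {X} {Y}) (λ {X Y} → c′ {X} {Y})
       | irrelevant d d′ | irrelevant e e′ | irrelevant f f′
       | irrelevant g g′
       | irrelevant (λ {X Y} → h {X} {Y}) (λ {X Y} → h′ {X} {Y})
       | irrelevant i i′
       | irrelevant (λ {X Y} f {C D} → j {X} {Y} f {C} {D}) (λ {X Y} f {C D} → j′ {X} {Y} f {C} {D})
  ... | refl | refl | refl | refl | refl | refl | refl | refl | refl | refl = refl

  functorOver-≡ : {Obj Obj′ : Set o} {F₀ : Obj → Obj′}
                  {𝐂 : CategoryOn Obj ℓ} {𝐃 : CategoryOn Obj′ ℓ} {F G : FunctorOver F₀ 𝐂 𝐃} →
                  (∀ {X Y} (f : CategoryOn.Hom 𝐂 X Y) → FunctorOver.map F f ≡ FunctorOver.map G f) →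
                  F ≡ G
  functorOver-≡
    {F = record { map = m ; map-id = i ; map-⨾ = c }}
    {record { map = m′ ; map-id = i′ ; map-⨾ = c′ }} p
    with funextⁱ {f = λ {X Y} → m {X} {Y}} {λ {X Y} → m′ {X} {Y}} (funextⁱ (funext p))
  ... | refl
    with irrelevant (λ {X} → i {X}) (λ {X} → i′ {X})
       | irrelevant (λ {X Y Z} → c {X} {Y} {Z}) (λ {X Y Z} → c′ {X} {Y} {Z})
  ... | refl | refl = refl

  -- The whiskerings return as `η id ⊛ f` and `f ⊛ η id`, and the braiding of `ℂ` as the regraded
  -- one of `𝕍`; the other data are definitionally the original ones.
  from∘to-obj : (𝐀 : FreydCategory o ℓ) → Functor.obj from (Functor.obj to 𝐀) ≡ 𝐀
  from∘to-obj 𝐀 = freydCategory-≡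
    (symmetricEffectful-≡ refl refl refl
      (≡-to-≅ (strictPremonoidal-≡ refl
        (≡-to-≅ (funext λ A → functorOver-≡ λ f →
          ≡.trans (≡.cong (_⊛ f) η.map-id) (⊛-idˡ A f)))
        (≡-to-≅ (funext λ A → functorOver-≡ λ f →
          ≡.trans (≡.cong (f ⊛_) η.map-id) (⊛-idʳ f A)))))
      (≡-to-≅ (funext λ X → funext λ Y → η-σ X Y))
      refl)
    refl
    where
    open FreydCategory 𝐀
    open SequentialTensor ℂ
    module η = FunctorOver η

  -- The categories agree only after extensionality in the grade. Comparing regradings and tensors
  -- pointwise, at given grades and on heterogeneously equal arguments, leaves room to split on the
  -- grades, where the categories compute.
  gradedMonoidal-≡ : {𝐂 𝐃 : GradedMonoidal 𝟐 o ℓ} →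
    GradedMonoidal.objects 𝐂 ≡ GradedMonoidal.objects 𝐃 →
    GradedMonoidal.category 𝐂 ≅ GradedMonoidal.category 𝐃 →
    (∀ {a b} (p : a ⩽ b) → GradedMonoidal.regrading 𝐂 p ≅ GradedMonoidal.regrading 𝐃 p) →
    (∀ {a b c} (p : a ⊕ b ↦ c) {X X̂ Y Ŷ X′ X̂′ Y′ Ŷ′}
       {f : GradedMonoidal.Hom 𝐂 a X Y} {f̂ : GradedMonoidal.Hom 𝐃 a X̂ Ŷ}
       {g : GradedMonoidal.Hom 𝐂 b X′ Y′} {ĝ : GradedMonoidal.Hom 𝐃 b X̂′ Ŷ′} →
       X ≅ X̂ → Y ≅ Ŷ → X′ ≅ X̂′ → Y′ ≅ Ŷ′ → f ≅ f̂ → g ≅ ĝ →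
       GradedMonoidal.tensor 𝐂 p f g ≅ GradedMonoidal.tensor 𝐃 p f̂ ĝ) →
    𝐂 ≡ 𝐃
  gradedMonoidal-≡
    {record
      { regrading = r ; tensor = t ; regrade-refl = a ; regrade-trans = b ; regrade-tensor = c
      ; tensor-identityˡ = d ; tensor-identityʳ = e ; tensor-assoc = f
      ; tensor-id = g ; tensor-⨾ = h }}
    {record
      { regrading = r′ ; tensor = t′ ; regrade-refl = a′ ; regrade-trans = b′ ; regrade-tensor = c′
      ; tensor-identityˡ = d′ ; tensor-identityʳ = e′ ; tensor-assoc = f′
      ; tensor-id = g′ ; tensor-⨾ = h′ }}
    refl refl p q
    with funextⁱ {f = λ {a b} → r {a} {b}} {λ {a b} → r′ {a} {b}}
           (funextⁱ (funext λ x → ≅-to-≡ (p x)))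
       | funextⁱ {f = λ {a b c} x {X Y X′ Y′} → t {a} {b} {c} x {X} {Y} {X′} {Y′}}
           {λ {a b c} x {X Y X′ Y′} → t′ {a} {b} {c} x {X} {Y} {X′} {Y′}}
           (funextⁱ (funextⁱ (funext λ x → funextⁱ (funextⁱ (funextⁱ (funextⁱ (funext λ f → funext λ g →
             ≅-to-≡ (q x refl refl refl refl refl refl))))))))
  ... | refl | refl
    with irrelevant (λ {x} p {X Y} → a {x} p {X} {Y}) (λ {x} p {X Y} → a′ {x} p {X} {Y})
       | irrelevant (λ {x y z} p q r {X Y} → b {x} {y} {z} p q r {X} {Y})
           (λ {x y z} p q r {X Y} → b′ {x} {y} {z} p q r {X} {Y})
       | irrelevant (λ {x y z u v w} p q r s t {X Y X′ Y′} →
              c {x} {y} {z} {u} {v} {w} p q r s t {X} {Y} {X′} {Y′})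
           (λ {x y z u v w} p q r s t {X Y X′ Y′} →
              c′ {x} {y} {z} {u} {v} {w} p q r s t {X} {Y} {X′} {Y′})
       | irrelevant (λ {x X Y} → d {x} {X} {Y}) (λ {x X Y} → d′ {x} {X} {Y})
       | irrelevant (λ {x X Y} → e {x} {X} {Y}) (λ {x X Y} → e′ {x} {X} {Y})
       | irrelevant (λ {x y z u v w} p q r s {X Y X′ Y′ X″ Y″} →
              f {x} {y} {z} {u} {v} {w} p q r s {X} {Y} {X′} {Y′} {X″} {Y″})
           (λ {x y z u v w} p q r s {X Y X′ Y′ X″ Y″} →
              f′ {x} {y} {z} {u} {v} {w} p q r s {X} {Y} {X′} {Y′} {X″} {Y″})
       | irrelevant (λ {X Y} → g {X} {Y}) (λ {X Y} → g′ {X} {Y})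
       | irrelevant (λ {x y z} p {X Y Z X′ Y′ Z′} → h {x} {y} {z} p {X} {Y} {Z} {X′} {Y′} {Z′})
           (λ {x y z} p {X Y Z X′ Y′ Z′} → h′ {x} {y} {z} p {X} {Y} {Z} {X′} {Y′} {Z′})
  ... | refl | refl | refl | refl | refl | refl | refl | refl = refl

  cartesianGraded-≡ : {𝐂 𝐃 : CartesianGraded 𝟐 o ℓ} →
    CartesianGraded.graded 𝐂 ≡ CartesianGraded.graded 𝐃 →
    SymmetricGraded.pureSymmetric (CartesianGraded.symmetric 𝐂) ≅
      SymmetricGraded.pureSymmetric (CartesianGraded.symmetric 𝐃) →
    CartesianGraded.cartesian 𝐂 ≅ CartesianGraded.cartesian 𝐃 → 𝐂 ≡ 𝐃
  cartesianGraded-≡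
    {record { symmetric = record { σ-natural-graded = a } }}
    {record { symmetric = record { σ-natural-graded = a′ } }} refl refl refl
    with irrelevant (λ {x y z} p q {X Y X′ Y′} → a {x} {y} {z} p q {X} {Y} {X′} {Y′})
           (λ {x y z} p q {X Y X′ Y′} → a′ {x} {y} {z} p q {X} {Y} {X′} {Y′})
  ... | refl = refl

  to∘from-obj : (𝐂 : CartesianGraded 𝟐 o ℓ) → Functor.obj to (Functor.obj from 𝐂) ≡ 𝐂
  to∘from-obj 𝐂 = cartesianGraded-≡
    (gradedMonoidal-≡ refl (≡-to-≅ (funext λ { zero → refl ; one → refl })) regrading-≅ tensor-≅)
    refl refl
    where
    open CartesianGraded 𝐂
    open GradedToFreyd 𝐂
    module C = FreydToGraded freydCategory

    regrading-≅ : ∀ {a b} (p : a ⩽ b) → C.regrading p ≅ regrading p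
    regrading-≅ {zero} {zero} p = ≡-to-≅ (functorOver-≡ λ f → ≡.sym (regrade-refl p f))
    -- The round trip keeps only the regrading along `0⩽1`, and matching identifies `p` with that
    -- witness.
    regrading-≅ {zero} {one}  (one , refl) = refl
    regrading-≅ {one}  {one}  p = ≡-to-≅ (functorOver-≡ λ f → ≡.sym (regrade-refl p f))
    regrading-≅ {one}  {zero} p = one⋠zero p

    tensor-≅ : ∀ {a b c} (p : a ⊕ b ↦ c) {X X̂ Y Ŷ X′ X̂′ Y′ Ŷ′}
      {f : C.Hom a X Y} {f̂ : Hom a X̂ Ŷ} {g : C.Hom b X′ Y′} {ĝ : Hom b X̂′ Ŷ′} →
      X ≅ X̂ → Y ≅ Ŷ → X′ ≅ X̂′ → Y′ ≅ Ŷ′ → f ≅ f̂ → g ≅ ĝ →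
      C.tensor p f g ≅ tensor p f̂ ĝ
    tensor-≅ {zero} {zero} refl refl refl refl refl refl refl = refl
    tensor-≅ {zero} {one}  refl refl refl refl refl refl refl = ≡-to-≅ (η⋊-⨾-⋉ _ _)
    tensor-≅ {one}  {zero} refl refl refl refl refl refl refl = ≡-to-≅ (⋊-⨾-⋉η _ _)
    tensor-≅ {one}  {one}  ()

theorem4p15 : ∀ {o ℓ} → Extensionality (suc (o ⊔ ℓ)) (suc (o ⊔ ℓ)) →
    Isomorphism (Freyd o ℓ) (Cart 𝟐 -GradMon o ℓ)
theorem4p15 ext = record
  { to      = to
  ; from    = from
  ; from∘to = record
    { obj-inverse = from∘to-obj ext
    ; map-inverse = λ {𝐀} {𝐁} F → subst₂-≈Freyd (from∘to-obj ext 𝐀) (from∘to-obj ext 𝐁)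
        (λ { refl → refl }) (λ { refl refl refl → refl }) (λ { refl refl refl → refl })
    }
  ; to∘from = record
    { obj-inverse = to∘from-obj ext
    ; map-inverse = λ {𝐂} {𝐃} F → subst₂-≈Graded (to∘from-obj ext 𝐂) (to∘from-obj ext 𝐃)
        (λ { refl → refl })
        -- The categories of the round trip are defined by recursion on the grade, so they reduce to
        -- the original ones only at a constructor.
        (λ { zero refl refl refl → refl ; one refl refl refl → refl })
    }
  }
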